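{- Let $s,t\ge 1$ and $D\ge 3$, and let $\ell=2\lceil\log s/\log(D-1)\rceil+3$. Let $\mathcal{G}=\{G_1,\dots,G_t\}$ be an $s$-joined graph family on $n$ vertices. Let $\mathcal{H}$ be a $[t]$-edge-colored subdivision of $K_D$ with at least $\ell$ vertices between each branch vertex and with $\Delta^{mon}(\mathcal{H})\le D$. If $|V(\mathcal{H})|\le n-6sD$, then $\mathcal{G}$ contains $\mathcal{H}$.
   Context: $\mathcal{G}=\{G_1,\dots,G_t\}$ is a family of graphs on a common vertex set $V$ with $|V|=n$. Its auxiliary bipartite graph $B_{\mathcal G}$ has parts $V\times[t]$ and $V$, with $(u,i)$ adjacent to $v$ iff $uv\in E(G_i)$. The family is $s$-joined if for all $X\subseteq V\times[t]$ and $Y\subseteq V$ with $|X|,|Y|\ge s$ there is an edge of $B_{\mathcal G}$ between $X$ and $Y$. A $[t]$-edge-colored graph is a simple graph each of whose edges is colored from $[t]$; for a vertex $v$, $d_i(v)$ is the number of edges of color $i$ at $v$, and $\Delta^{mon}(\mathcal{H})=\max_{i\in[t]}\max_{v}d_i(v)$. A subdivision of $K_D$ is obtained from $K_D$ by replacing edges with internally vertex-disjoint paths; the original $D$ vertices are branch vertices. $\mathcal{G}$ contains $\mathcal{H}$ if there is an injective $\phi:V(\mathcal{H})\to V$ with $\phi(u)\phi(v)\in E(G_i)$ for every edge $uv$ of color $i$. -}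

module Defs where

open import Data.Nat using (ℕ; zero; suc; _+_; _*_; _∸_; _^_; _≤_; _<_)
open import Data.Fin using (Fin; toℕ) renaming (_<_ to _<ᶠ_)
open import Data.Fin.Properties using (_≟_)
open import Data.Bool using (Bool; true; false)
open import Data.Maybe using (Maybe; just; nothing; Is-just)
open import Data.List using (List; []; _∷_; _++_; length; filter; allFin)
open import Data.List.Membership.Propositional using (_∈_; _∉_)
open import Data.List.Relation.Unary.Unique.Propositional using (Unique)
open import Data.List.Relation.Unary.Linked using (Linked)
open import Data.Product using (_×_; _,_; ∃; ∃-syntax; Σ-syntax)
open import Data.Sum using (_⊎_)
open import Relation.Binary.PropositionalEquality using (_≡_; _≢_)
open import Relation.Nullary using (¬_)
open import Function.Definitions using (Injective)

record SimpleGraph (n : ℕ) : Set where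
  field
    adj   : Fin n → Fin n → Bool
    sym   : ∀ u v → adj u v ≡ adj v u
    irref : ∀ v → adj v v ≡ false

open SimpleGraph public

GraphFamily : ℕ → ℕ → Set
GraphFamily n t = Fin t → SimpleGraph n

-- s-joined: for all X ⊆ V × [t], Y ⊆ V with |X|,|Y| ≥ s there is an
-- edge of the auxiliary bipartite graph B_G between X and Y, i.e.
-- (u,i) ∈ X, v ∈ Y with uv ∈ E(G_i).  Subsets are given as duplicate-free lists.
SJoined : ∀ {n t} → ℕ → GraphFamily n t → Set
SJoined {n} {t} s G =
  (X : List (Fin n × Fin t)) (Y : List (Fin n)) →
  Unique X → Unique Y → s ≤ length X → s ≤ length Y →
  ∃[ u ] ∃[ i ] ∃[ v ] ((u , i) ∈ X × v ∈ Y × adj (G i) u v ≡ true)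

-- A [t]-edge-coloured simple graph on vertex set Fin m: col u v = just c
-- iff uv is an edge of colour c; nothing iff uv is not an edge.
record ColoredGraph (m t : ℕ) : Set where
  field
    col    : Fin m → Fin m → Maybe (Fin t)
    csym   : ∀ u v → col u v ≡ col v u
    cirref : ∀ v → col v v ≡ nothing

open ColoredGraph public

IsEdge : ∀ {m t} → ColoredGraph m t → Fin m → Fin m → Set
IsEdge H u v = Is-just (col H u v)

isColor : ∀ {t} → Fin t → Maybe (Fin t) → Bool
isColor c nothing = false
isColor c (just d) with c ≟ d
... | Relation.Nullary.yes _ = true
... | Relation.Nullary.no _ = false

colorDegree : ∀ {m t} → ColoredGraph m t → Fin t → Fin m → ℕ
colorDegree H c v = length (filter (λ w → isColor c (col H v w) Data.Bool.≟ true) (allFin _))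

MaxMonoDegreeAtMost : ∀ {m t} → ColoredGraph m t → ℕ → Set
MaxMonoDegreeAtMost H k = ∀ c v → colorDegree H c v ≤ k

Consecutive : ∀ {A : Set} → List A → A → A → Set
Consecutive {A} L x y = ∃[ pre ] ∃[ suf ] (L ≡ pre ++ (x ∷ y ∷ suf))

record SubdivisionOfK {m t : ℕ} (H : ColoredGraph m t) (D ℓ : ℕ) : Set where
  field
    branch    : Fin D → Fin m
    branchInj : Injective _≡_ _≡_ branch
    inner     : Fin D → Fin D → List (Fin m)
  fullPath : Fin D → Fin D → List (Fin m)
  fullPath i j = branch i ∷ (inner i j ++ (branch j ∷ []))
  field
    isPath      : ∀ i j → i <ᶠ j → Linked (IsEdge H) (fullPath i j)
    innerUnique : ∀ i j → i <ᶠ j → Unique (inner i j)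
    innerNotBranch : ∀ i j → i <ᶠ j → ∀ x → x ∈ inner i j → ∀ k → branch k ≢ x
    innerDisjoint : ∀ i j i' j' → i <ᶠ j → i' <ᶠ j' → ¬ (i ≡ i' × j ≡ j') →
                    ∀ x → x ∈ inner i j → x ∉ inner i' j'
    longPaths   : ∀ i j → i <ᶠ j → ℓ ≤ length (inner i j)
    edgesCovered : ∀ u v → IsEdge H u v →
                   ∃[ i ] ∃[ j ] (i <ᶠ j × (Consecutive (fullPath i j) u v ⊎ Consecutive (fullPath i j) v u))
    verticesCovered : ∀ x → (∃[ k ] branch k ≡ x) ⊎ (∃[ i ] ∃[ j ] (i <ᶠ j × x ∈ inner i j))

Contains : ∀ {n m t} → GraphFamily n t → ColoredGraph m t → Set
Contains {n} {m} G H =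
  Σ[ φ ∈ (Fin m → Fin n) ] (Injective _≡_ _≡_ φ ×
    (∀ u v c → col H u v ≡ just c → adj (G c) (φ u) (φ v) ≡ true))

-- ⌈ log s / log b ⌉ for b ≥ 2, s ≥ 1: the least k ∈ ℕ with s ≤ b ^ k.

IsCeilLog : ℕ → ℕ → ℕ → Set
IsCeilLog b s k = s ≤ b ^ k × (∀ j → s ≤ b ^ j → k ≤ j)

{-# OPTIONS --safe #-}

-- The proof is a rollback argument.  A partial embedding, kept as a forest E of coloured parent–child
-- edges in the host, is extendable if every set U of at most 2s pairs (vertex, colour) has at least
-- D |U| unused neighbours, where a neighbour already serving as a child of a pair in U still counts.
-- Sets with equality are closed under union by submodularity and smaller than s by joinedness, so a pair
-- with fewer than D children can always be given a new one: otherwise the union of the tight sets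
-- blocking the candidates, together with that pair, would violate extendability.  Deleting edges never
-- destroys extendability.  Discarding a maximal poorly expanding set of pairs makes the empty forest
-- extendable.
--
-- A path of the subdivision is then embedded by growing from both of its ends a path followed by a
-- (D-1)-ary tree of depth k = ⌈log s / log (D-1)⌉ with s leaves, joining two leaves in the colour of the
-- middle edge, and deleting everything in the two trees outside the path so obtained.

module Submission where

open import Defs hiding (sym)
open import Data.Bool using (Bool; true; false; not; _∧_; _∨_) renaming (_≟_ to _≟ᵇ_)
open import Data.Fin using (Fin; zero; suc; combine; remQuot) renaming (_<_ to _<ᶠ_)
open import Data.Fin.Properties
  using (_≟_; any?; combine-injective; combine-remQuot; remQuot-combine; injective⇒≤; <⇒≢; <-asym)
  renaming (_<?_ to _<ᶠ?_)
open import Data.Fin.Subset using (Subset; _∪_; _∩_; ⊥; ⁅_⁆)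
open import Data.Fin.Subset.Properties using (anySubset?)
open import Data.List
  using (List; []; _∷_; _++_; _ʳ++_; length; map; zip; take; replicate; concatMap; filter; allFin; cartesianProduct)
  renaming (tabulate to tabulateᴸ; lookup to lookupᴸ)
open import Data.List.Properties
  using (length-++; length-map; length-take; length-replicate; map-++; ++-assoc; ++-ʳ++; ʳ++-defn)
open import Data.List.Membership.Propositional using (_∈_; _∉_)
open import Data.List.Membership.Propositional.Properties
  using (∈-map⁺; ∈-map⁻; ∈-++⁺ˡ; ∈-++⁺ʳ; ∈-++⁻; ∈-allFin; ∈-filter⁺; ∈-filter⁻; ∈-cartesianProduct⁺; ∈-lookup)
open import Data.List.Relation.Binary.Permutation.Propositional using (_↭_; ↭-sym; ↭-trans; ↭-reflexive; ↭⇒↭ₛ)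
open import Data.List.Relation.Binary.Permutation.Propositional.Properties
  using (∈-resp-↭; ↭-reverse; ++-comm) renaming (++⁺ʳ to ↭-++⁺ʳ)
import Data.List.Relation.Binary.Permutation.Setoid.Properties as PermutationSetoid
open import Data.List.Relation.Binary.Sublist.Propositional
  using (_⊆_; []; _∷_; _∷ʳ_; ⊆-refl; ⊆-trans) renaming (lookup to ⊆-lookup)
import Data.List.Relation.Binary.Sublist.Propositional.Properties as Sublist
open import Data.List.Relation.Unary.All as All using (All; []; _∷_)
import Data.List.Relation.Unary.All.Properties as All
open import Data.List.Relation.Unary.AllPairs using ([]; _∷_)
open import Data.List.Relation.Unary.Any using (here; there)
open import Data.List.Relation.Unary.Linked as Linked using (Linked; []; [-]; _∷_)
open import Data.List.Relation.Unary.Unique.Propositional using (Unique)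
open import Data.List.Relation.Unary.Unique.Propositional.Properties
  using (allFin⁺; filter⁺; map⁺; ++⁺; cartesianProduct⁺)
open import Data.Maybe using (Maybe; just; nothing; Is-just)
open import Data.Maybe.Relation.Unary.Any using (just)
open import Data.Nat using (ℕ; zero; suc; _+_; _*_; _∸_; _^_; _⊓_; _≤_; _<_; z≤n; s≤s; _≤?_; _<?_)
open import Data.Nat.Properties hiding (_≟_; <⇒≢; <-asym)
open import Data.Nat.Tactic.RingSolver using (solve-∀)
open import Data.Product using (_×_; _,_; ∃; ∃-syntax; proj₁; proj₂; uncurry)
open import Data.Sum using (_⊎_; inj₁; inj₂; [_,_]′)
open import Data.Unit using (tt)
open import Data.Vec using (lookup)
open import Data.Vec.Properties using (lookup-zipWith; lookup-replicate)
open import Function using (_∘_; id)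
open import Relation.Binary using (Symmetric)
open import Relation.Binary.PropositionalEquality
open import Relation.Nullary using (¬_; Dec; yes; no; does; contradiction)
open import Relation.Nullary.Decidable using (dec-true; dec-false; _×-dec_)
open import Algebra.Properties.CommutativeMonoid.Sum +-0-commutativeMonoid
  using (sum; ∑-distrib-+; sum-cong-≗; sum-replicate-zero; ∑-comm)

-- Counting in finite sets

-- Extendability is a condition on pairs, whereas a partial embedding occupies vertices. A vertex
-- with one poorly expanding colour is given up altogether, since a path may prescribe any colour
-- there. Discarding a bad set therefore removes its neighbours, so that the sets disjoint from it
-- keep their expansion, and also the vertices that carry its pairs.
--
-- The bound 2s is twice the size at which joinedness takes over: two tight sets have fewer than s
-- pairs each, so their union is still governed by the condition, and joinedness then puts it below
-- s again.
--
-- Colours are prescribed along a path, so all edges on one level of a tree receive the colour of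
-- the path edge at that distance from the branch vertex. Every leaf then ends a correctly coloured
-- path, and joinedness may choose any of them. The joining edge never enters the forest: both of
-- its ends are used already, so it costs extendability nothing.

⟦_⟧ : Bool → ℕ
⟦ true ⟧ = 1
⟦ false ⟧ = 0

# : ∀ {n} → (Fin n → Bool) → ℕ
# f = sum (λ i → ⟦ f i ⟧)

sum-mono : ∀ {n} {f g : Fin n → ℕ} → (∀ i → f i ≤ g i) → sum f ≤ sum g
sum-mono {zero} h = z≤n
sum-mono {suc n} h = +-mono-≤ (h zero) (sum-mono (h ∘ suc))

⟦⟧-mono : ∀ {a b} → (a ≡ true → b ≡ true) → ⟦ a ⟧ ≤ ⟦ b ⟧
⟦⟧-mono {true} h rewrite h refl = ≤-refl
⟦⟧-mono {false} h = z≤n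

-- Submodularity at a single vertex, to be summed: `a` and `b` stand for membership in the
-- neighbourhoods of a union and an intersection. Implications suffice, and for the intersection no
-- more is true: a common neighbour of two sets need not be a neighbour of their intersection.
⟦⟧-submodular : ∀ {a b c d} → (a ≡ true → c ∨ d ≡ true) → (b ≡ true → c ∧ d ≡ true) →
                ⟦ a ⟧ + ⟦ b ⟧ ≤ ⟦ c ⟧ + ⟦ d ⟧
⟦⟧-submodular {false} {false} f g = z≤n
⟦⟧-submodular {_} {true} {true} {true} f g = ⟦a⟧≤1+1 _
  where
  ⟦a⟧≤1+1 : ∀ a → ⟦ a ⟧ + 1 ≤ 2
  ⟦a⟧≤1+1 true = ≤-refl
  ⟦a⟧≤1+1 false = s≤s z≤n
⟦⟧-submodular {_} {true} {true} {false} f g = contradiction (g refl) λ ()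
⟦⟧-submodular {_} {true} {false} {_} f g = contradiction (g refl) λ ()
⟦⟧-submodular {true} {false} {true} {_} f g = s≤s z≤n
⟦⟧-submodular {true} {false} {false} {true} f g = s≤s z≤n
⟦⟧-submodular {true} {false} {false} {false} f g = contradiction (f refl) λ ()

#-mono : ∀ {n} {f g : Fin n → Bool} → (∀ i → f i ≡ true → g i ≡ true) → # f ≤ # g
#-mono h = sum-mono (λ i → ⟦⟧-mono (h i))

#-+-mono : ∀ {n} {a b c d : Fin n → Bool} →
           (∀ i → ⟦ a i ⟧ + ⟦ b i ⟧ ≤ ⟦ c i ⟧ + ⟦ d i ⟧) → # a + # b ≤ # c + # d
#-+-mono {a = a} {b} {c} {d} h = begin
  # a + # b                        ≡⟨ ∑-distrib-+ (λ i → ⟦ a i ⟧) (λ i → ⟦ b i ⟧) ⟨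
  sum (λ i → ⟦ a i ⟧ + ⟦ b i ⟧)    ≤⟨ sum-mono h ⟩
  sum (λ i → ⟦ c i ⟧ + ⟦ d i ⟧)    ≡⟨ ∑-distrib-+ (λ i → ⟦ c i ⟧) (λ i → ⟦ d i ⟧) ⟩
  # c + # d                        ∎
  where open ≤-Reasoning

#-false : ∀ n → # {n} (λ _ → false) ≡ 0
#-false n = sum-replicate-zero n

#-true : ∀ n → # {n} (λ _ → true) ≡ n
#-true zero = refl
#-true (suc n) = cong suc (#-true n)

#-subadd : ∀ {n} {a c d : Fin n → Bool} → (∀ i → a i ≡ true → c i ∨ d i ≡ true) → # a ≤ # c + # d
#-subadd {n} {a} {c} {d} h = begin
  # a                     ≡⟨ +-identityʳ _ ⟨
  # a + 0                 ≡⟨ cong (# a +_) (#-false n) ⟨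
  # a + # {n} (λ _ → false) ≤⟨ #-+-mono {a = a} {λ _ → false} {c} {d} (λ i → ⟦⟧-submodular {a i} {false} {c i} {d i} (h i) (λ ())) ⟩
  # c + # d               ∎
  where open ≤-Reasoning

≟-refl : ∀ {n} (v : Fin n) → does (v ≟ v) ≡ true
≟-refl v = dec-true (v ≟ v) refl

#-remove : ∀ {n} (f : Fin n → Bool) w → # (λ v → not (does (w ≟ v)) ∧ f v) + ⟦ f w ⟧ ≡ # f
#-remove {suc n} f zero = +-comm (# (f ∘ suc)) ⟦ f zero ⟧
#-remove {suc n} f (suc w) =
  trans (+-assoc ⟦ f zero ⟧ _ ⟦ f (suc w) ⟧)
    (cong (⟦ f zero ⟧ +_) (trans (cong (_+ ⟦ f (suc w) ⟧) (sum-cong-≗ same)) (#-remove (f ∘ suc) w)))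
  where
  same : ∀ v → ⟦ not (does (suc w ≟ suc v)) ∧ f (suc v) ⟧ ≡ ⟦ not (does (w ≟ v)) ∧ f (suc v) ⟧
  same v with w ≟ v
  ... | yes _ = refl
  ... | no _ = refl

#-singleton : ∀ {n} (w : Fin n) → # (λ v → does (w ≟ v)) ≡ 1
#-singleton {suc n} zero = cong suc (#-false n)
#-singleton {suc n} (suc w) = trans (sum-cong-≗ same) (#-singleton w)
  where
  same : ∀ v → ⟦ does (suc w ≟ suc v) ⟧ ≡ ⟦ does (w ≟ v) ⟧
  same v with w ≟ v
  ... | yes _ = refl
  ... | no _ = refl

lookup-⁅⁆ : ∀ {n} (w v : Fin n) → lookup ⁅ w ⁆ v ≡ does (w ≟ v)
lookup-⁅⁆ zero zero = refl
lookup-⁅⁆ zero (suc v) = lookup-replicate v false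
lookup-⁅⁆ (suc w) zero = refl
lookup-⁅⁆ (suc w) (suc v) with w ≟ v | lookup-⁅⁆ w v
... | yes _ | e = e
... | no _ | e = e

size : ∀ {N} → Subset N → ℕ
size U = # (lookup U)

size-⊥ : ∀ N → size {N} ⊥ ≡ 0
size-⊥ N = trans (sum-cong-≗ {N} (λ i → cong ⟦_⟧ (lookup-replicate i false))) (#-false N)

size-⁅⁆ : ∀ {N} (w : Fin N) → size ⁅ w ⁆ ≡ 1
size-⁅⁆ w = trans (sum-cong-≗ (λ v → cong ⟦_⟧ (lookup-⁅⁆ w v))) (#-singleton w)

∧-elim : ∀ {a b} → a ∧ b ≡ true → a ≡ true × b ≡ true
∧-elim {true} {true} _ = refl , refl

∨-elim : ∀ {a b} → a ∨ b ≡ true → a ≡ true ⊎ b ≡ true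
∨-elim {true} _ = inj₁ refl
∨-elim {false} e = inj₂ e

∨-intro : ∀ {a b} → a ≡ true ⊎ b ≡ true → a ∨ b ≡ true
∨-intro (inj₁ refl) = refl
∨-intro {true} (inj₂ refl) = refl
∨-intro {false} (inj₂ refl) = refl

∧-intro : ∀ {a b} → a ≡ true → b ≡ true → a ∧ b ≡ true
∧-intro refl refl = refl

⟦∨⟧+⟦∧⟧ : ∀ a b → ⟦ a ∨ b ⟧ + ⟦ a ∧ b ⟧ ≡ ⟦ a ⟧ + ⟦ b ⟧
⟦∨⟧+⟦∧⟧ true b = refl
⟦∨⟧+⟦∧⟧ false b = +-identityʳ ⟦ b ⟧

lookup-∪ : ∀ {N} (U W : Subset N) q → lookup (U ∪ W) q ≡ lookup U q ∨ lookup W q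
lookup-∪ U W q = lookup-zipWith _∨_ q U W

lookup-∩ : ∀ {N} (U W : Subset N) q → lookup (U ∩ W) q ≡ lookup U q ∧ lookup W q
lookup-∩ U W q = lookup-zipWith _∧_ q U W

size-∪-∩ : ∀ {N} (U W : Subset N) → size (U ∪ W) + size (U ∩ W) ≡ size U + size W
size-∪-∩ U W = begin
  size (U ∪ W) + size (U ∩ W)                                 ≡⟨ ∑-distrib-+ (λ q → ⟦ lookup (U ∪ W) q ⟧) (λ q → ⟦ lookup (U ∩ W) q ⟧) ⟨
  sum (λ q → ⟦ lookup (U ∪ W) q ⟧ + ⟦ lookup (U ∩ W) q ⟧)     ≡⟨ sum-cong-≗ (λ q → trans (cong₂ (λ a b → ⟦ a ⟧ + ⟦ b ⟧) (lookup-∪ U W q) (lookup-∩ U W q)) (⟦∨⟧+⟦∧⟧ (lookup U q) _)) ⟩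
  sum (λ q → ⟦ lookup U q ⟧ + ⟦ lookup W q ⟧)                 ≡⟨ ∑-distrib-+ (λ q → ⟦ lookup U q ⟧) (λ q → ⟦ lookup W q ⟧) ⟩
  size U + size W                                             ∎
  where open ≡-Reasoning

size-∪-≤ : ∀ {N} (U W : Subset N) → size (U ∪ W) ≤ size U + size W
size-∪-≤ U W = ≤-trans (m≤m+n _ _) (≤-reflexive (size-∪-∩ U W))

size-∩-≤ : ∀ {N} (U W : Subset N) → size (U ∩ W) ≤ size U
size-∩-≤ U W = #-mono (λ q e → proj₁ (∧-elim (trans (sym (lookup-∩ U W q)) e)))

not-true : ∀ {a} → not a ≡ true → a ≡ false
not-true {false} _ = refl

occ : ∀ {n} → Fin n → List (Fin n) → ℕ
occ x [] = 0
occ x (y ∷ ys) = ⟦ does (x ≟ y) ⟧ + occ x ys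

elements : ∀ {N} → (Fin N → Bool) → List (Fin N)
elements f = filter (λ v → f v ≟ᵇ true) (allFin _)

length-elements : ∀ {N} (f : Fin N → Bool) → length (elements f) ≡ # f
length-elements {N} f = go id
  where
  go : ∀ {k} (g : Fin k → Fin N) → length (filter (λ v → f v ≟ᵇ true) (tabulateᴸ g)) ≡ # (f ∘ g)
  go {zero} g = refl
  go {suc k} g with f (g zero)
  ... | true = cong suc (go (g ∘ suc))
  ... | false = go (g ∘ suc)

elements-unique : ∀ {N} (f : Fin N → Bool) → Unique (elements f)
elements-unique f = filter⁺ _ (allFin⁺ _)

∈-elements : ∀ {N} (f : Fin N → Bool) {v} → v ∈ elements f → f v ≡ true
∈-elements f = proj₂ ∘ ∈-filter⁻ (λ v → f v ≟ᵇ true) {xs = allFin _}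

#-complement : ∀ {n} (f : Fin n → Bool) → # f + # (not ∘ f) ≡ n
#-complement {n} f = trans (sym (∑-distrib-+ (λ v → ⟦ f v ⟧) (λ v → ⟦ not (f v) ⟧)))
  (trans (sum-cong-≗ (λ v → bit (f v))) (#-true n))
  where
  bit : ∀ b → ⟦ b ⟧ + ⟦ not b ⟧ ≡ 1
  bit true = refl
  bit false = refl

term≤sum : ∀ {n} (f : Fin n → ℕ) i → f i ≤ sum f
term≤sum f zero = m≤m+n _ _
term≤sum f (suc i) = ≤-trans (term≤sum (f ∘ suc) i) (m≤n+m _ _)

-- Extendable forests

-- (just (u , c) , w) makes w the child of u along colour c; (nothing , w) makes w a root.
Edge : ℕ → ℕ → Set
Edge n t = Maybe (Fin n × Fin t) × Fin n

-- Pairs (vertex, colour) are coded by `combine` in `Fin (n * t)`, so that sets of pairs are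
-- `Subset`s and can be searched exhaustively. The adjacency is a parameter, and need not be
-- symmetric, because modified versions of the family are used as well.
module Neighbourhood {n t : ℕ} (adj : Fin n → Fin t → Fin n → Bool) where

  nbr? : (U : Subset (n * t)) (v : Fin n) →
         Dec (∃[ q ] (lookup U q ∧ adj (proj₁ (remQuot {n} t q)) (proj₂ (remQuot {n} t q)) v) ≡ true)
  nbr? U v = any? (λ q → _ ≟ᵇ true)

  nbr : Subset (n * t) → Fin n → Bool
  nbr U v = does (nbr? U v)

  nbr-intro : ∀ U {u c v} → lookup U (combine u c) ≡ true → adj u c v ≡ true → nbr U v ≡ true
  nbr-intro U {u} {c} {v} m a = dec-true (nbr? U v) (combine u c , ∧-intro m a′)
    where
    a′ : adj (proj₁ (remQuot {n} t (combine u c))) (proj₂ (remQuot {n} t (combine u c))) v ≡ true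
    a′ = subst (λ r → adj (proj₁ r) (proj₂ r) v ≡ true) (sym (remQuot-combine u c)) a

  nbr-witness : ∀ U {v} → nbr U v ≡ true →
             ∃[ q ] lookup U q ≡ true × adj (proj₁ (remQuot {n} t q)) (proj₂ (remQuot {n} t q)) v ≡ true
  nbr-witness U {v} e with nbr? U v
  ... | yes (q , h) = q , ∧-elim h

  nbr-mono : ∀ U W → (∀ q → lookup U q ≡ true → lookup W q ≡ true) → ∀ {v} → nbr U v ≡ true → nbr W v ≡ true
  nbr-mono U W h {v} e with nbr-witness U e
  ... | q , m , a = dec-true (nbr? W v) (q , ∧-intro (h q m) a)

  nbr-∪ : ∀ U W {v} → nbr (U ∪ W) v ≡ true → nbr U v ≡ true ⊎ nbr W v ≡ true
  nbr-∪ U W {v} e with nbr-witness (U ∪ W) e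
  ... | q , m , a with ∨-elim (trans (sym (lookup-∪ U W q)) m)
  ...   | inj₁ m′ = inj₁ (dec-true (nbr? U v) (q , ∧-intro m′ a))
  ...   | inj₂ m′ = inj₂ (dec-true (nbr? W v) (q , ∧-intro m′ a))

  nbr-∩ : ∀ U W {v} → nbr (U ∩ W) v ≡ true → nbr U v ≡ true × nbr W v ≡ true
  nbr-∩ U W e =
    nbr-mono (U ∩ W) U (λ q m → proj₁ (∧-elim (trans (sym (lookup-∩ U W q)) m))) e ,
    nbr-mono (U ∩ W) W (λ q m → proj₂ (∧-elim {lookup U q} (trans (sym (lookup-∩ U W q)) m))) e

  nbr-⁅⁆ : ∀ {u c v} → nbr ⁅ combine u c ⁆ v ≡ true → adj u c v ≡ true
  nbr-⁅⁆ {u} {c} {v} e with nbr-witness ⁅ combine u c ⁆ e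
  ... | q , m , a with combine u c ≟ q | trans (sym (lookup-⁅⁆ (combine u c) q)) m
  ...   | yes refl | _ = subst (λ r → adj (proj₁ r) (proj₂ r) v ≡ true) (remQuot-combine u c) a

module Extendability {n t : ℕ} (s D : ℕ) (adj : Fin n → Fin t → Fin n → Bool) (X : Fin n → Bool)
  (joined : ∀ U → s ≤ size U → n < # (Neighbourhood.nbr adj U) + s) where

  open Neighbourhood adj public

  hits : Subset (n * t) → Maybe (Fin n × Fin t) → Bool
  hits U nothing = false
  hits U (just (u , c)) = lookup U (combine u c)

  -- The vertices of `X` count as used from the start, so no edge ever ends in one of them.
  used : List (Edge n t) → Fin n → Bool
  used [] v = X v
  used ((_ , w) ∷ E) v = does (w ≟ v) ∨ used E v

  hitCount : List (Edge n t) → Subset (n * t) → ℕ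
  hitCount [] U = 0
  hitCount ((p , _) ∷ E) U = ⟦ hits U p ⟧ + hitCount E U

  free : List (Edge n t) → Subset (n * t) → Fin n → Bool
  free E U v = not (used E v) ∧ nbr U v

  Φ : List (Edge n t) → Subset (n * t) → ℕ
  Φ E U = # (free E U) + hitCount E U

  -- A pair with h children in E still demands D ∸ h neighbours; hitCount moves the subtracted terms to the right.
  record Ext (E : List (Edge n t)) : Set where
    constructor mkExt
    field bound : ∀ U → size U ≤ 2 * s → D * size U ≤ Φ E U

  open Ext

  data Valid : List (Edge n t) → Set where
    []  : Valid []
    _∷_ : ∀ {p w E} → (used E w ≡ false × (∀ {u c} → p ≡ just (u , c) → adj u c w ≡ true)) →
          Valid E → Valid ((p , w) ∷ E)

  -- A new edge removes `w` from the free neighbours if `U` sees it, and adds one hit if the parent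
  -- lies in `U`. Both changes are written as additions, which avoids truncated subtraction.
  Φ-∷ : ∀ {p w E} U → used E w ≡ false → Φ ((p , w) ∷ E) U + ⟦ nbr U w ⟧ ≡ Φ E U + ⟦ hits U p ⟧
  Φ-∷ {p} {w} {E} U fresh = begin
    # (free ((p , w) ∷ E) U) + (⟦ hits U p ⟧ + hitCount E U) + ⟦ nbr U w ⟧
      ≡⟨ cong (λ z → z + (⟦ hits U p ⟧ + hitCount E U) + ⟦ nbr U w ⟧) (sum-cong-≗ (λ v → cong ⟦_⟧ (split (does (w ≟ v)) (used E v) (nbr U v)))) ⟩
    A + (⟦ hits U p ⟧ + hitCount E U) + ⟦ nbr U w ⟧
      ≡⟨ cong (λ b → A + (⟦ hits U p ⟧ + hitCount E U) + ⟦ b ⟧) (sym free-w) ⟩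
    A + (⟦ hits U p ⟧ + hitCount E U) + ⟦ free E U w ⟧
      ≡⟨ shuffle A ⟦ hits U p ⟧ (hitCount E U) ⟦ free E U w ⟧ ⟩
    (A + ⟦ free E U w ⟧) + hitCount E U + ⟦ hits U p ⟧
      ≡⟨ cong (λ z → z + hitCount E U + ⟦ hits U p ⟧) (#-remove (free E U) w) ⟩
    Φ E U + ⟦ hits U p ⟧ ∎
    where
    open ≡-Reasoning
    A : ℕ
    A = # (λ v → not (does (w ≟ v)) ∧ free E U v)
    split : ∀ a b c → not (a ∨ b) ∧ c ≡ not a ∧ (not b ∧ c)
    split true b c = refl
    split false b c = refl
    free-w : free E U w ≡ nbr U w
    free-w rewrite fresh = refl
    shuffle : ∀ a h k b → a + (h + k) + b ≡ (a + b) + k + h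
    shuffle = solve-∀

  -- The only edges that cost `U` anything: a child whose parent lies in `U` also leaves `free`, but
  -- `hitCount` repays it.
  loss : List (Edge n t) → Subset (n * t) → ℕ
  loss [] U = 0
  loss ((p , w) ∷ E) U = ⟦ nbr U w ∧ not (hits U p) ⟧ + loss E U

  hits⇒nbr : ∀ {p w} U → (∀ {u c} → p ≡ just (u , c) → adj u c w ≡ true) → hits U p ≡ true → nbr U w ≡ true
  hits⇒nbr {just _} U a h = nbr-intro U h (a refl)

  -- In this form Φ is visibly antitone in E, which makes every sublist of an extendable list extendable.
  Φ+loss : ∀ {E} U → Valid E → Φ E U + loss E U ≡ # (λ v → not (X v) ∧ nbr U v)
  Φ+loss U [] = trans (+-identityʳ _) (+-identityʳ _)
  Φ+loss {(p , w) ∷ E} U ((fresh , a) ∷ val) = begin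
    Φ ((p , w) ∷ E) U + (⟦ nbr U w ∧ not (hits U p) ⟧ + loss E U) ≡⟨ +-cancelʳ-≡ ⟦ hits U p ⟧ _ _ key ⟩
    Φ E U + loss E U ≡⟨ Φ+loss U val ⟩
    _ ∎
    where
    open ≡-Reasoning
    bit : ∀ x h → (h ≡ true → x ≡ true) → ⟦ x ∧ not h ⟧ + ⟦ h ⟧ ≡ ⟦ x ⟧
    bit true true _ = refl
    bit true false _ = refl
    bit false false _ = refl
    bit false true f = contradiction (f refl) λ ()
    s1 : ∀ a b c d → a + (b + c) + d ≡ a + (b + d) + c
    s1 = solve-∀
    s2 : ∀ a b c → a + b + c ≡ a + c + b
    s2 = solve-∀
    key : Φ ((p , w) ∷ E) U + (⟦ nbr U w ∧ not (hits U p) ⟧ + loss E U) + ⟦ hits U p ⟧ ≡ Φ E U + loss E U + ⟦ hits U p ⟧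
    key = begin
      Φ ((p , w) ∷ E) U + (⟦ nbr U w ∧ not (hits U p) ⟧ + loss E U) + ⟦ hits U p ⟧ ≡⟨ s1 (Φ ((p , w) ∷ E) U) _ _ _ ⟩
      Φ ((p , w) ∷ E) U + (⟦ nbr U w ∧ not (hits U p) ⟧ + ⟦ hits U p ⟧) + loss E U ≡⟨ cong (λ z → Φ ((p , w) ∷ E) U + z + loss E U) (bit _ _ (hits⇒nbr U a)) ⟩
      Φ ((p , w) ∷ E) U + ⟦ nbr U w ⟧ + loss E U ≡⟨ cong (_+ loss E U) (Φ-∷ {p} {w} {E} U fresh) ⟩
      Φ E U + ⟦ hits U p ⟧ + loss E U ≡⟨ s2 (Φ E U) _ _ ⟩
      Φ E U + loss E U + ⟦ hits U p ⟧ ∎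

  loss-mono : ∀ {E′ E} U → E′ ⊆ E → loss E′ U ≤ loss E U
  loss-mono U [] = z≤n
  loss-mono U (e ∷ʳ sub) = ≤-trans (loss-mono U sub) (m≤n+m _ _)
  loss-mono {x ∷ _} U (refl ∷ sub) = +-monoʳ-≤ ⟦ nbr U (proj₂ x) ∧ not (hits U (proj₁ x)) ⟧ (loss-mono U sub)

  used-mono : ∀ {E′ E} → E′ ⊆ E → ∀ {v} → used E′ v ≡ true → used E v ≡ true
  used-mono [] h = h
  used-mono (e ∷ʳ sub) h = ∨-intro (inj₂ (used-mono sub h))
  used-mono {(_ , w) ∷ _} (refl ∷ sub) {v} h with does (w ≟ v)
  ... | true = refl
  ... | false = used-mono sub h

  Valid-mono : ∀ {E′ E} → E′ ⊆ E → Valid E → Valid E′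
  Valid-mono [] val = val
  Valid-mono (e ∷ʳ sub) (_ ∷ val) = Valid-mono sub val
  Valid-mono {(_ , w) ∷ E′} (refl ∷ sub) ((fresh , a) ∷ val) = (unused , a) ∷ Valid-mono sub val
    where
    unused : used E′ w ≡ false
    unused with used E′ w in eq
    ... | false = refl
    ... | true = contradiction (trans (sym (used-mono sub eq)) fresh) λ ()

  Ext-mono : ∀ {E′ E} → E′ ⊆ E → Valid E → Ext E → Ext E′
  Ext-mono {E′} {E} sub val ext = mkExt λ U h → ≤-trans (bound ext U h) (+-cancelʳ-≤ (loss E U) (Φ E U) (Φ E′ U) (begin
    Φ E U + loss E U    ≡⟨ Φ+loss U val ⟩
    _                   ≡⟨ Φ+loss U (Valid-mono sub val) ⟨
    Φ E′ U + loss E′ U  ≤⟨ +-monoʳ-≤ (Φ E′ U) (loss-mono U sub) ⟩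
    Φ E′ U + loss E U   ∎))
    where open ≤-Reasoning

  hitCount-∪-∩ : ∀ E U W → hitCount E (U ∪ W) + hitCount E (U ∩ W) ≡ hitCount E U + hitCount E W
  hitCount-∪-∩ [] U W = refl
  hitCount-∪-∩ ((p , w) ∷ E) U W =
    trans (shuffle ⟦ hits (U ∪ W) p ⟧ _ ⟦ hits (U ∩ W) p ⟧ _)
      (trans (cong₂ _+_ (one p) (hitCount-∪-∩ E U W)) (sym (shuffle ⟦ hits U p ⟧ _ ⟦ hits W p ⟧ _)))
    where
    shuffle : ∀ a b c d → (a + b) + (c + d) ≡ (a + c) + (b + d)
    shuffle = solve-∀
    one : ∀ p → ⟦ hits (U ∪ W) p ⟧ + ⟦ hits (U ∩ W) p ⟧ ≡ ⟦ hits U p ⟧ + ⟦ hits W p ⟧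
    one nothing = refl
    one (just (u , c)) rewrite lookup-∪ U W (combine u c) | lookup-∩ U W (combine u c) =
      ⟦∨⟧+⟦∧⟧ (lookup U (combine u c)) _

  Φ-submodular : ∀ E U W → Φ E (U ∪ W) + Φ E (U ∩ W) ≤ Φ E U + Φ E W
  Φ-submodular E U W = begin
    Φ E (U ∪ W) + Φ E (U ∩ W)
      ≡⟨ shuffle (# (free E (U ∪ W))) (hitCount E (U ∪ W)) (# (free E (U ∩ W))) (hitCount E (U ∩ W)) ⟩
    (# (free E (U ∪ W)) + # (free E (U ∩ W))) + (hitCount E (U ∪ W) + hitCount E (U ∩ W))
      ≤⟨ +-mono-≤ (#-+-mono {a = free E (U ∪ W)} {free E (U ∩ W)} {free E U} {free E W} pointwise)
           (≤-reflexive (hitCount-∪-∩ E U W)) ⟩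
    (# (free E U) + # (free E W)) + (hitCount E U + hitCount E W)
      ≡⟨ shuffle (# (free E U)) (# (free E W)) (hitCount E U) (hitCount E W) ⟩
    Φ E U + Φ E W ∎
    where
    open ≤-Reasoning
    shuffle : ∀ a b c d → (a + b) + (c + d) ≡ (a + c) + (b + d)
    shuffle = solve-∀
    pointwise : ∀ v → ⟦ free E (U ∪ W) v ⟧ + ⟦ free E (U ∩ W) v ⟧ ≤ ⟦ free E U v ⟧ + ⟦ free E W v ⟧
    pointwise v with used E v
    ... | true = z≤n
    ... | false = ⟦⟧-submodular {nbr (U ∪ W) v} {nbr (U ∩ W) v} {nbr U v} {nbr W v} (λ h → ∨-intro (nbr-∪ U W h))
                    (λ h → let (x , y) = nbr-∩ U W h in ∧-intro x y)

  -- Tight sets and the extension step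

  Room : List (Edge n t) → Set
  Room E = # (used E) + D * (2 * s) + s ≤ n

  nbr≤used+free : ∀ E U → # (nbr U) ≤ # (used E) + # (free E U)
  nbr≤used+free E U = #-subadd {a = nbr U} {used E} {free E U} pointwise
    where
    pointwise : ∀ v → nbr U v ≡ true → used E v ∨ free E U v ≡ true
    pointwise v h with used E v
    ... | true = refl
    ... | false = h

  -- Joinedness leaves fewer than `s` vertices outside the neighbourhood of `U`. `Room` reserves
  -- those, the used vertices and the largest possible demand `D * (2 * s)`, so the inequality is
  -- strict.
  large-slack : ∀ E → Room E → ∀ U → s ≤ size U → size U ≤ 2 * s → D * size U < Φ E U
  large-slack E room U s≤U U≤2s = ≤-trans (s≤s (*-monoʳ-≤ D U≤2s)) (≤-trans (+-cancelʳ-≤ (# (used E) + s) (suc (D * (2 * s))) (# (free E U)) (begin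
    suc (D * (2 * s)) + (# (used E) + s)   ≡⟨ r1 (D * (2 * s)) (# (used E)) s ⟩
    suc (# (used E) + D * (2 * s) + s)     ≤⟨ s≤s room ⟩
    suc n                                  ≤⟨ joined U s≤U ⟩
    # (nbr U) + s                          ≤⟨ +-monoˡ-≤ s (nbr≤used+free E U) ⟩
    # (used E) + # (free E U) + s          ≡⟨ r2 (# (used E)) (# (free E U)) s ⟩
    # (free E U) + (# (used E) + s)        ∎)) (m≤m+n _ (hitCount E U)))
    where
    open ≤-Reasoning
    r1 : ∀ a b c → suc a + (b + c) ≡ suc (b + a + c)
    r1 = solve-∀
    r2 : ∀ a b c → a + b + c ≡ b + (a + c)
    r2 = solve-∀

  -- Only one half of the equality is recorded, the other being `Ext`. The field `small` is what
  -- keeps the union of two tight sets within the range of `Ext`.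
  record Tight (E : List (Edge n t)) (U : Subset (n * t)) : Set where
    constructor mkTight
    field
      small : size U < s
      exact : Φ E U ≤ D * size U

  tight : ∀ E → Room E → ∀ U → size U ≤ 2 * s → Φ E U ≤ D * size U → Tight E U
  tight E room U U≤2s le with s ≤? size U
  ... | no s≰U = mkTight (≰⇒> s≰U) le
  ... | yes s≤U = contradiction (large-slack E room U s≤U U≤2s) (≤⇒≯ le)

  <s+<s⇒≤2s : ∀ {a b} → a < s → b < s → a + b ≤ 2 * s
  <s+<s⇒≤2s {a} {b} h k = ≤-trans (+-mono-≤ (<⇒≤ h) (<⇒≤ k)) (≤-reflexive (cong (s +_) (sym (+-identityʳ s))))

  -- `Ext` bounds `Φ` of the intersection from below, so submodularity leaves no excess for the
  -- union. That the union again has fewer than `s` pairs cannot come from counting; it comes from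
  -- `large-slack` through `tight`.
  tight-∪ : ∀ {E} → Ext E → Room E → ∀ {U W} → Tight E U → Tight E W → Tight E (U ∪ W)
  tight-∪ {E} ext room {U} {W} (mkTight U<s tU) (mkTight W<s tW) = tight E room (U ∪ W) U∪W≤2s (+-cancelʳ-≤ (D * size (U ∩ W)) (Φ E (U ∪ W)) (D * size (U ∪ W)) (begin
    Φ E (U ∪ W) + D * size (U ∩ W)         ≤⟨ +-monoʳ-≤ (Φ E (U ∪ W)) (bound ext (U ∩ W) U∩W≤2s) ⟩
    Φ E (U ∪ W) + Φ E (U ∩ W)              ≤⟨ Φ-submodular E U W ⟩
    Φ E U + Φ E W                          ≤⟨ +-mono-≤ tU tW ⟩
    D * size U + D * size W                ≡⟨ *-distribˡ-+ D (size U) (size W) ⟨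
    D * (size U + size W)                  ≡⟨ cong (D *_) (size-∪-∩ U W) ⟨
    D * (size (U ∪ W) + size (U ∩ W))      ≡⟨ *-distribˡ-+ D (size (U ∪ W)) _ ⟩
    D * size (U ∪ W) + D * size (U ∩ W)    ∎))
    where
    open ≤-Reasoning
    U∪W≤2s : size (U ∪ W) ≤ 2 * s
    U∪W≤2s = ≤-trans (size-∪-≤ U W) (<s+<s⇒≤2s U<s W<s)
    U∩W≤2s : size (U ∩ W) ≤ 2 * s
    U∩W≤2s = ≤-trans (size-∩-≤ U W) (≤-trans (m≤m+n _ (size W)) (<s+<s⇒≤2s U<s W<s))

  nbr-⊥ : ∀ {v} → nbr ⊥ v ≡ false
  nbr-⊥ {v} = dec-false (nbr? ⊥ v) λ (q , h) →
    contradiction (trans (sym (proj₁ (∧-elim h))) (lookup-replicate q false)) λ ()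

  Φ-⊥ : ∀ E → Φ E ⊥ ≡ 0
  Φ-⊥ E = cong₂ _+_ (trans (sum-cong-≗ (λ v → cong ⟦_⟧ (no-free v))) (#-false n)) (no-hits E)
    where
    no-free : ∀ v → free E ⊥ v ≡ false
    no-free v rewrite nbr-⊥ {v} with used E v
    ... | true = refl
    ... | false = refl
    no-hits : ∀ E → hitCount E ⊥ ≡ 0
    no-hits [] = refl
    no-hits ((nothing , _) ∷ E) = no-hits E
    no-hits ((just (u , c) , _) ∷ E) rewrite lookup-replicate {n = n * t} (combine u c) false = no-hits E

  tight-⊥ : 1 ≤ s → ∀ E → Tight E ⊥
  tight-⊥ 1≤s E = mkTight (≤-trans (≤-reflexive (cong suc (size-⊥ (n * t)))) 1≤s) (≤-trans (≤-reflexive (Φ-⊥ E)) z≤n)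

  -- Extendability quantifies over finitely many sets, so its failure yields an actual violating
  -- set.
  Ext-violation : ∀ E → Ext E ⊎ (∃[ U ] size U ≤ 2 * s × Φ E U < D * size U)
  Ext-violation E with anySubset? (λ U → (size U ≤? 2 * s) ×-dec (Φ E U <? D * size U))
  ... | yes w = inj₂ w
  ... | no none = inj₁ (mkExt λ U h → ≮⇒≥ λ lt → none (U , h , lt))

  target : Maybe (Fin n × Fin t) → Fin n → Bool
  target nothing v = true
  target (just (u , c)) v = adj u c v

  -- Here `y` and `x` are the values of `Φ` before and after adding an edge, and `d` is the demand.
  -- Since `Φ` falls by at most one, a violation afterwards forces equality before, a child seen by
  -- the set and a parent outside it.
  drop-one : ∀ b h {x y d} → x + ⟦ b ⟧ ≡ y + ⟦ h ⟧ → d ≤ y → x < d → y ≤ d × h ≡ false × b ≡ true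
  drop-one true false {x} {y} e d≤y x<d =
    ≤-trans (≤-reflexive (trans (sym (+-identityʳ y)) (trans (sym e) (+-comm x 1)))) x<d , refl , refl
  drop-one true true e d≤y x<d = contradiction d≤y (<⇒≱ (subst (_< _) (+-cancelʳ-≡ 1 _ _ e) x<d))
  drop-one false h {x} {y} e d≤y x<d = contradiction d≤y
    (<⇒≱ (≤-<-trans (≤-trans (m≤m+n y ⟦ h ⟧) (≤-reflexive (trans (sym e) (+-identityʳ x)))) x<d))

  violation⇒tight : ∀ {E p w} → Ext E → Room E → used E w ≡ false → ∀ U → size U ≤ 2 * s →
    Φ ((p , w) ∷ E) U < D * size U → Tight E U × hits U p ≡ false × nbr U w ≡ true
  violation⇒tight {E} {p} {w} ext room fresh U U≤2s lt
    with drop-one (nbr U w) (hits U p) (Φ-∷ {p} {w} {E} U fresh) (bound ext U U≤2s) lt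
  ... | le , rest = tight E room U U≤2s le , rest

  Extension : List (Edge n t) → Maybe (Fin n × Fin t) → Set
  Extension E p = ∃[ w ] used E w ≡ false × target p w ≡ true × Ext ((p , w) ∷ E)

  -- Each failing candidate supplies a tight set that sees it and misses `p`; `tight-∪` merges these
  -- into a single one, starting from the empty set. Missing `p` has to be carried along, because
  -- adding the parent must later enlarge the set.
  extension-or-tight : 1 ≤ s → ∀ {E} p → Ext E → Room E → ∀ L → Extension E p ⊎
    (∃[ U ] Tight E U × hits U p ≡ false ×
      (∀ w → w ∈ L → used E w ≡ false → target p w ≡ true → nbr U w ≡ true))
  extension-or-tight 1≤s {E} p ext room [] = inj₂ (⊥ , tight-⊥ 1≤s E , no-hit p , λ _ ())
    where
    no-hit : ∀ p → hits ⊥ p ≡ false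
    no-hit nothing = refl
    no-hit (just (u , c)) = lookup-replicate {n = n * t} (combine u c) false
  extension-or-tight 1≤s {E} p ext room (w ∷ L) with extension-or-tight 1≤s p ext room L
  ... | inj₁ found = inj₁ found
  ... | inj₂ (U , tU , U∌p , cover) with used E w in fresh | target p w in tgt
  ... | true | _ = inj₂ (U , tU , U∌p , λ where
          _ (here refl) f _ → contradiction (trans (sym fresh) f) λ ()
          w′ (there m) → cover w′ m)
  ... | false | false = inj₂ (U , tU , U∌p , λ where
          _ (here refl) _ g → contradiction (trans (sym tgt) g) λ ()
          w′ (there m) → cover w′ m)
  ... | false | true with Ext-violation ((p , w) ∷ E)
  ... | inj₁ ext′ = inj₁ (w , fresh , tgt , ext′)
  ... | inj₂ (W , W≤2s , lt) with violation⇒tight {E} {p} {w} ext room fresh W W≤2s lt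
  ... | tW , W∌p , w∈NW = inj₂ (U ∪ W , tight-∪ ext room tU tW , avoid p U∌p W∌p , λ where
          _ (here refl) _ _ → nbr-mono W (U ∪ W) (λ q h → trans (lookup-∪ U W q) (∨-intro (inj₂ h))) w∈NW
          w′ (there m) f g → nbr-mono U (U ∪ W) (λ q h → trans (lookup-∪ U W q) (∨-intro (inj₁ h))) (cover w′ m f g))
    where
    avoid : ∀ p → hits U p ≡ false → hits W p ≡ false → hits (U ∪ W) p ≡ false
    avoid nothing _ _ = refl
    avoid (just (u , c)) x y rewrite lookup-∪ U W (combine u c) | x | y = refl

  parents : List (Edge n t) → List (Fin n)
  parents [] = []
  parents ((nothing , _) ∷ E) = parents E
  parents ((just (u , _) , _) ∷ E) = u ∷ parents E

  -- The children of `u` are counted over all colours, which overestimates those of the pair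
  -- `(u , c)`. This lets the embedding keep track of one number per vertex.
  hitCount-∪-⁅⁆ : ∀ E U u c → hitCount E (U ∪ ⁅ combine u c ⁆) ≤ hitCount E U + occ u (parents E)
  hitCount-∪-⁅⁆ [] U u c = z≤n
  hitCount-∪-⁅⁆ ((nothing , _) ∷ E) U u c = hitCount-∪-⁅⁆ E U u c
  hitCount-∪-⁅⁆ ((just (u′ , c′) , _) ∷ E) U u c = begin
    ⟦ lookup (U ∪ ⁅ combine u c ⁆) (combine u′ c′) ⟧ + hitCount E (U ∪ ⁅ combine u c ⁆)
      ≤⟨ +-mono-≤ one (hitCount-∪-⁅⁆ E U u c) ⟩
    (⟦ lookup U (combine u′ c′) ⟧ + ⟦ does (u ≟ u′) ⟧) + (hitCount E U + occ u (parents E))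
      ≡⟨ shuffle ⟦ lookup U (combine u′ c′) ⟧ _ _ _ ⟩
    (⟦ lookup U (combine u′ c′) ⟧ + hitCount E U) + (⟦ does (u ≟ u′) ⟧ + occ u (parents E)) ∎
    where
    open ≤-Reasoning
    shuffle : ∀ a b c d → (a + b) + (c + d) ≡ (a + c) + (b + d)
    shuffle = solve-∀
    sound : does (combine u c ≟ combine u′ c′) ≡ true → does (u ≟ u′) ≡ true
    sound e with combine u c ≟ combine u′ c′
    ... | yes eq = dec-true (u ≟ u′) (proj₁ (combine-injective u c u′ c′ eq))
    one : ⟦ lookup (U ∪ ⁅ combine u c ⁆) (combine u′ c′) ⟧ ≤ ⟦ lookup U (combine u′ c′) ⟧ + ⟦ does (u ≟ u′) ⟧
    one rewrite lookup-∪ U ⁅ combine u c ⁆ (combine u′ c′) | lookup-⁅⁆ (combine u c) (combine u′ c′)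
      with lookup U (combine u′ c′)
    ... | true = s≤s z≤n
    ... | false = ⟦⟧-mono sound

  -- The candidates for w are all covered by one tight set U, so adding the parent to U violates extendability.
  extend : 1 ≤ s → ∀ {E} u c → Ext E → Room E → occ u (parents E) < D → Extension E (just (u , c))
  extend 1≤s {E} u c ext room slack with extension-or-tight 1≤s (just (u , c)) ext room (allFin n)
  ... | inj₁ found = found
  ... | inj₂ (U , mkTight U<s tU , U∌p , cover) = contradiction chain (<⇒≱ (+-monoʳ-< (D * size U) slack))
    where
    open ≤-Reasoning
    q = combine u c
    W = U ∪ ⁅ q ⁆
    U∩q : size (U ∩ ⁅ q ⁆) ≡ 0
    U∩q = trans (sum-cong-≗ {n * t} (λ v → cong ⟦_⟧ (zero-at v))) (#-false (n * t))
      where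
      zero-at : ∀ v → lookup (U ∩ ⁅ q ⁆) v ≡ false
      zero-at v rewrite lookup-∩ U ⁅ q ⁆ v | lookup-⁅⁆ q v with q ≟ v
      ... | yes refl rewrite U∌p = refl
      ... | no _ with lookup U v
      ...   | true = refl
      ...   | false = refl
    size-W : size W ≡ size U + 1
    size-W = trans (sym (+-identityʳ _)) (trans (cong (size W +_) (sym U∩q))
      (trans (size-∪-∩ {n * t} U ⁅ q ⁆) (cong (size U +_) (size-⁅⁆ q))))
    W≤2s : size W ≤ 2 * s
    W≤2s = ≤-trans (≤-reflexive (trans size-W (+-comm _ 1))) (≤-trans U<s (m≤m+n s (1 * s)))
    free-W : ∀ v → free E W v ≡ true → free E U v ≡ true
    free-W v h with used E v in fresh
    ... | false with nbr-∪ U ⁅ q ⁆ h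
    ...   | inj₁ x = x
    ...   | inj₂ y = cover v (∈-allFin v) fresh (nbr-⁅⁆ y)
    chain : D * size U + D ≤ D * size U + occ u (parents E)
    chain = begin
      D * size U + D                                     ≡⟨ distr D (size U) ⟩
      D * (size U + 1)                                   ≡⟨ cong (D *_) size-W ⟨
      D * size W                                         ≤⟨ bound ext W W≤2s ⟩
      Φ E W                                              ≤⟨ +-mono-≤ (#-mono {f = free E W} {free E U} free-W) (hitCount-∪-⁅⁆ E U u c) ⟩
      # (free E U) + (hitCount E U + occ u (parents E))  ≡⟨ +-assoc (# (free E U)) _ _ ⟨
      Φ E U + occ u (parents E)                          ≤⟨ +-monoˡ-≤ _ tU ⟩
      D * size U + occ u (parents E)                     ∎
      where
      distr : ∀ a b → a * b + a ≡ a * (b + 1)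
      distr = solve-∀

  extend-root : 1 ≤ s → ∀ {E} → Ext E → Room E → Extension E nothing
  extend-root 1≤s {E} ext room with extension-or-tight 1≤s nothing ext room (allFin n)
  ... | inj₁ found = found
  ... | inj₂ (U , mkTight U<s tU , _ , cover) = contradiction chain (<⇒≱ (+-monoʳ-< (# (used E) + D * (2 * s)) 1≤s))
    where
    open ≤-Reasoning
    pointwise : ∀ (v : Fin n) → true ≡ true → used E v ∨ free E U v ≡ true
    pointwise v _ with used E v in fresh
    ... | true = refl
    ... | false = cover v (∈-allFin v) fresh refl
    chain : # (used E) + D * (2 * s) + s ≤ # (used E) + D * (2 * s) + 0
    chain = begin
      # (used E) + D * (2 * s) + s    ≤⟨ room ⟩
      n                               ≡⟨ #-true n ⟨
      # {n} (λ _ → true)              ≤⟨ #-subadd {a = λ _ → true} {used E} {free E U} pointwise ⟩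
      # (used E) + # (free E U)       ≤⟨ +-monoʳ-≤ (# (used E)) (m≤m+n (# (free E U)) (hitCount E U)) ⟩
      # (used E) + Φ E U              ≤⟨ +-monoʳ-≤ (# (used E)) tU ⟩
      # (used E) + D * size U         ≤⟨ +-monoʳ-≤ (# (used E)) (*-monoʳ-≤ D (≤-trans (<⇒≤ U<s) (m≤m+n s (1 * s)))) ⟩
      # (used E) + D * (2 * s)        ≡⟨ +-identityʳ _ ⟨
      # (used E) + D * (2 * s) + 0    ∎

  #-used : ∀ E → # (used E) ≤ # X + length E
  #-used [] = m≤m+n _ _
  #-used ((p , w) ∷ E) = begin
    # (used ((p , w) ∷ E))                      ≤⟨ #-subadd {a = used ((p , w) ∷ E)} {λ v → does (w ≟ v)} {used E} (λ _ h → h) ⟩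
    # (λ v → does (w ≟ v)) + # (used E)         ≡⟨ cong (_+ # (used E)) (#-singleton w) ⟩
    suc (# (used E))                            ≤⟨ s≤s (#-used E) ⟩
    suc (# X + length E)                        ≡⟨ +-suc (# X) (length E) ⟨
    # X + suc (length E)                        ∎
    where open ≤-Reasoning

-- Discarding poorly expanding pairs

familyAdj : ∀ {n t} → GraphFamily n t → Fin n → Fin t → Fin n → Bool
familyAdj G u c v = adj (G c) u v

remQuot-injective : ∀ {n} t {i j : Fin (n * t)} → remQuot {n} t i ≡ remQuot {n} t j → i ≡ j
remQuot-injective {n} t {i} {j} e =
  trans (sym (combine-remQuot {n} t i)) (trans (cong (uncurry combine) e) (combine-remQuot {n} t j))

module Expansion {n t : ℕ} (s D : ℕ) (G : GraphFamily n t) (sjoined : SJoined s G)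
  (1≤s : 1 ≤ s) (3≤D : 3 ≤ D) (6sD≤n : 6 * s * D ≤ n) where

  private
    module N = Neighbourhood (familyAdj G)

  joined : ∀ U → s ≤ size U → n < # (N.nbr U) + s
  joined U s≤U = ≰⇒> λ small →
    let
      Y = elements (not ∘ N.nbr U)
      s≤Y : s ≤ length Y
      s≤Y = ≤-trans (+-cancelˡ-≤ (# (N.nbr U)) _ _ (≤-trans small (≤-reflexive (sym (#-complement (N.nbr U))))))
              (≤-reflexive (sym (length-elements (not ∘ N.nbr U))))
      u , c , v , u∈ , v∈ , a = sjoined (map (remQuot {n} t) (elements (lookup U))) Y
        (map⁺ (remQuot-injective t) (elements-unique (lookup U))) (elements-unique _)
        (≤-trans s≤U (≤-reflexive (sym (trans (length-map (remQuot {n} t) (elements (lookup U))) (length-elements (lookup U)))))) s≤Y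
      q , q∈ , eq = ∈-map⁻ (remQuot {n} t) u∈
      q≡ : combine u c ≡ q
      q≡ = trans (cong (uncurry combine) eq) (combine-remQuot {n} t q)
      hit : N.nbr U v ≡ true
      hit = N.nbr-intro U (trans (cong (lookup U) q≡) (∈-elements (lookup U) q∈)) a
    in contradiction (trans (sym hit) (not-true (∈-elements (not ∘ N.nbr U) v∈))) λ ()

  -- Adding the edges from (u , c) to u makes every vertex carrying a bad pair a neighbour, so that it is discarded too.
  reflexiveAdj selfAdj : Fin n → Fin t → Fin n → Bool
  reflexiveAdj u c v = familyAdj G u c v ∨ does (u ≟ v)
  selfAdj u c v = does (u ≟ v)

  private
    module N⁺ = Neighbourhood reflexiveAdj
    module N° = Neighbourhood selfAdj

  #-self≤size : ∀ U → # (N°.nbr U) ≤ size U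
  #-self≤size U = begin
    # (N°.nbr U)                     ≤⟨ sum-mono (λ v → pointwise v) ⟩
    sum (λ v → sum (λ q → incident v q))   ≡⟨ ∑-comm {n} {n * t} incident ⟩
    sum (λ q → sum (λ v → incident v q))   ≤⟨ sum-mono column ⟩
    size U                           ∎
    where
    open ≤-Reasoning
    base : Fin (n * t) → Fin n
    base q = proj₁ (remQuot {n} t q)
    incident : Fin n → Fin (n * t) → ℕ
    incident v q = ⟦ lookup U q ∧ does (base q ≟ v) ⟧
    pointwise : ∀ v → ⟦ N°.nbr U v ⟧ ≤ sum (incident v)
    pointwise v with N°.nbr U v in e
    ... | false = z≤n
    ... | true with N°.nbr-witness U e
    ...   | q , m , a = ≤-trans (≤-reflexive (sym (cong ⟦_⟧ (∧-intro m a)))) (term≤sum (incident v) q)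
    column : ∀ q → sum (λ v → incident v q) ≤ ⟦ lookup U q ⟧
    column q with lookup U q
    ... | true = ≤-reflexive (#-singleton (base q))
    ... | false = ≤-reflexive (#-false n)

  -- The factor is `D + 1` rather than `D` to pay for the reflexive edges: they contribute at most
  -- one neighbour per pair, so subtracting them leaves expansion by `D`.
  record Bad (W : Subset (n * t)) : Set where
    constructor mkBad
    field
      small : size W ≤ 2 * s
      poor : # (N⁺.nbr W) ≤ (D + 1) * size W

  open Bad

  MaximalBad : Subset (n * t) → Set
  MaximalBad W = Bad W × (∀ W′ → Bad W′ → size W′ ≤ size W)

  maximal-above : ∀ fuel W → Bad W → 2 * s < size W + fuel → ∃ MaximalBad
  maximal-above zero W bad lt = contradiction (small bad) (<⇒≱ (subst (2 * s <_) (+-identityʳ _) lt))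
  maximal-above (suc fuel) W bad lt
    with anySubset? (λ W′ → (size W <? size W′) ×-dec ((size W′ ≤? 2 * s) ×-dec (# (N⁺.nbr W′) ≤? (D + 1) * size W′)))
  ... | yes (W′ , larger , sm , po) = maximal-above fuel W′ (mkBad sm po)
          (≤-trans lt (≤-trans (≤-reflexive (+-suc (size W) fuel)) (+-monoˡ-≤ fuel larger)))
  ... | no none = W , bad , λ W′ bad′ → ≮⇒≥ λ lt′ → none (W′ , lt′ , small bad′ , poor bad′)

  maximalBad : ∃ MaximalBad
  maximalBad = maximal-above (suc (2 * s)) ⊥ (mkBad (≤-trans (≤-reflexive (size-⊥ (n * t))) z≤n) poor-⊥) (m≤n+m _ _)
    where
    none : ∀ v → N⁺.nbr ⊥ v ≡ true → false ≡ true
    none v h with N⁺.nbr-witness ⊥ h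
    ... | q , m , _ = trans (sym (lookup-replicate q false)) m
    poor-⊥ : # (N⁺.nbr ⊥) ≤ (D + 1) * size {n * t} ⊥
    poor-⊥ = ≤-trans (#-mono {f = N⁺.nbr ⊥} {λ _ → false} none) (≤-trans (≤-reflexive (#-false n)) z≤n)

  W : Subset (n * t)
  W = proj₁ maximalBad

  discarded : Fin n → Bool
  discarded = N⁺.nbr W

  W-bad : Bad W
  W-bad = proj₁ (proj₂ maximalBad)

  W-maximal : ∀ W′ → Bad W′ → size W′ ≤ size W
  W-maximal = proj₂ (proj₂ maximalBad)

  3s≤sD : 3 * s ≤ s * D
  3s≤sD = ≤-trans (≤-reflexive (*-comm 3 s)) (*-monoʳ-≤ s 3≤D)

  -- With `s` pairs, joinedness would give `W` more than `n` minus `s` neighbours, whereas a bad set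
  -- has at most `(D + 1) * (2 * s)`.
  size-W<s : size W < s
  size-W<s = ≰⇒> λ s≤W → <⇒≱ (joined W s≤W) (begin
    # (N.nbr W) + s                     ≤⟨ +-monoˡ-≤ s (#-mono {f = N.nbr W} {N⁺.nbr W} incl) ⟩
    # (N⁺.nbr W) + s                    ≤⟨ +-monoˡ-≤ s (poor W-bad) ⟩
    (D + 1) * size W + s                ≤⟨ +-monoˡ-≤ s (*-monoʳ-≤ (D + 1) (small W-bad)) ⟩
    (D + 1) * (2 * s) + s               ≡⟨ expand s D ⟩
    2 * (s * D) + 3 * s                 ≤⟨ +-monoʳ-≤ (2 * (s * D)) 3s≤sD ⟩
    2 * (s * D) + s * D                 ≤⟨ m≤m+n _ (3 * (s * D)) ⟩
    2 * (s * D) + s * D + 3 * (s * D)   ≡⟨ collect s D ⟩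
    6 * s * D                           ≤⟨ 6sD≤n ⟩
    n                                   ∎)
    where
    open ≤-Reasoning
    expand : ∀ s D → (D + 1) * (2 * s) + s ≡ 2 * (s * D) + 3 * s
    expand = solve-∀
    collect : ∀ s D → 2 * (s * D) + s * D + 3 * (s * D) ≡ 6 * s * D
    collect = solve-∀
    incl : ∀ v → N.nbr W v ≡ true → N⁺.nbr W v ≡ true
    incl v h with N.nbr-witness W h
    ... | q , m , a = dec-true (N⁺.nbr? W v) (q , ∧-intro m (∨-intro (inj₁ a)))

  #-discarded : # discarded ≤ (D + 1) * s
  #-discarded = ≤-trans (poor W-bad) (*-monoʳ-≤ (D + 1) (<⇒≤ size-W<s))

  -- Joining every bad pair to all vertices frees the extendability condition from exceptions;
  -- bad pairs live on discarded vertices, so these extra edges are never used.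
  saturatedAdj : Fin n → Fin t → Fin n → Bool
  saturatedAdj u c v = lookup W (combine u c) ∨ familyAdj G u c v

  private
    module N′ = Neighbourhood saturatedAdj

  nbr⇒saturated : ∀ U v → N.nbr U v ≡ true → N′.nbr U v ≡ true
  nbr⇒saturated U v h with N.nbr-witness U h
  ... | q , m , a = dec-true (N′.nbr? U v) (q , ∧-intro m (∨-intro (inj₂ a)))

  saturated-joined : ∀ U → s ≤ size U → n < # (N′.nbr U) + s
  saturated-joined U s≤U = ≤-trans (joined U s≤U)
    (+-monoˡ-≤ s (#-mono {f = N.nbr U} {N′.nbr U} (nbr⇒saturated U)))

  saturated-sound : ∀ {u c v} → discarded u ≡ false → saturatedAdj u c v ≡ true → adj (G c) u v ≡ true
  saturated-sound {u} {c} keep a with lookup W (combine u c) in m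
  ... | false = a
  ... | true = contradiction (trans (sym (N⁺.nbr-intro W m (∨-intro (inj₂ (≟-refl u))))) keep) λ ()

  open Extendability s D saturatedAdj discarded saturated-joined public

  -- Where `6 * s * D` is spent: `(D + 1) * s` on discarded vertices, `6 * s` on the two trees
  -- standing besides the embedded part, and `D * (2 * s) + s` on the demand and the vertices missed
  -- by a set of `s` pairs. The sum is `3 * (s * D) + 8 * s`, and `3 ≤ D` absorbs the last term.
  room : ∀ {m} E → m + 6 * s * D ≤ n → length E ≤ m + 6 * s → Room E
  room {m} E m+6sD≤n E≤ = begin
    # (used E) + D * (2 * s) + s                       ≤⟨ +-monoˡ-≤ s (+-monoˡ-≤ (D * (2 * s)) (#-used E)) ⟩
    # discarded + length E + D * (2 * s) + s           ≤⟨ +-monoˡ-≤ s (+-monoˡ-≤ (D * (2 * s)) (+-mono-≤ #-discarded E≤)) ⟩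
    (D + 1) * s + (m + 6 * s) + D * (2 * s) + s        ≡⟨ expand s D m ⟩
    m + (3 * (s * D) + 8 * s)                          ≤⟨ +-monoʳ-≤ m (+-monoʳ-≤ (3 * (s * D)) (m≤m+n (8 * s) s)) ⟩
    m + (3 * (s * D) + (8 * s + s))                    ≡⟨ regroup s D m ⟩
    m + (3 * (s * D) + 3 * (3 * s))                    ≤⟨ +-monoʳ-≤ m (+-monoʳ-≤ (3 * (s * D)) (*-monoʳ-≤ 3 3s≤sD)) ⟩
    m + (3 * (s * D) + 3 * (s * D))                    ≡⟨ collect s D m ⟩
    m + 6 * s * D                                      ≤⟨ m+6sD≤n ⟩
    n                                                  ∎
    where
    open ≤-Reasoning
    expand : ∀ s D m → (D + 1) * s + (m + 6 * s) + D * (2 * s) + s ≡ m + (3 * (s * D) + 8 * s)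
    expand = solve-∀
    regroup : ∀ s D m → m + (3 * (s * D) + (8 * s + s)) ≡ m + (3 * (s * D) + 3 * (3 * s))
    regroup = solve-∀
    collect : ∀ s D m → m + (3 * (s * D) + 3 * (s * D)) ≡ m + 6 * s * D
    collect = solve-∀

  -- Three kinds of sets: those with at least `s` pairs expand by joinedness; those meeting `W` see
  -- every vertex through the saturating edges; for a small set disjoint from `W`, the union with
  -- `W` is too large to be bad, and subtracting the few neighbours of `W` leaves enough for `U`.
  Ext-[] : Ext []
  Ext-[] = mkExt expand
    where
    open ≤-Reasoning
    room-[] : Room []
    room-[] = room {0} [] 6sD≤n z≤n
    small-case : ∀ U → size U < s → (∀ q → lookup U q ∧ lookup W q ≡ true → false ≡ true) → D * size U ≤ Φ [] U
    small-case U U<s apart with size U in sizeU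
    -- The empty set is treated apart because maximality says nothing about it: its union with `W`
    -- is no larger than `W`.
    ... | zero = ≤-trans (≤-reflexive (*-zeroʳ D)) z≤n
    ... | suc a = +-cancelˡ-≤ (size U) _ _ (+-cancelˡ-≤ ((D + 1) * size W) _ _ (begin
      (D + 1) * size W + (size U + D * suc a)          ≡⟨ cong (λ z → (D + 1) * size W + (size U + D * z)) sizeU ⟨
      (D + 1) * size W + (size U + D * size U)         ≡⟨ distr D (size U) (size W) ⟩
      (D + 1) * (size U + size W)                      ≡⟨ cong ((D + 1) *_) size-U∪W ⟨
      (D + 1) * size (U ∪ W)                           ≤⟨ <⇒≤ rich ⟩
      # (N⁺.nbr (U ∪ W))                               ≤⟨ #-subadd {a = N⁺.nbr (U ∪ W)} {discarded} {kept⁺} cover ⟩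
      # discarded + # kept⁺                            ≤⟨ +-mono-≤ (poor W-bad) kept-split ⟩
      (D + 1) * size W + (# (free [] U) + # (N°.nbr U))  ≤⟨ +-monoʳ-≤ ((D + 1) * size W) (+-monoʳ-≤ (# (free [] U)) (#-self≤size U)) ⟩
      (D + 1) * size W + (# (free [] U) + size U)        ≡⟨ cong ((D + 1) * size W +_) (trans (+-comm (# (free [] U)) (size U)) (cong (size U +_) (sym (+-identityʳ _)))) ⟩
      (D + 1) * size W + (size U + Φ [] U)             ∎))
      where
      distr : ∀ D a b → (D + 1) * b + (a + D * a) ≡ (D + 1) * (a + b)
      distr = solve-∀
      size-U∩W : size (U ∩ W) ≡ 0
      size-U∩W = n≤0⇒n≡0 (≤-trans (#-mono {f = lookup (U ∩ W)} {λ _ → false} (λ q h → apart q (trans (sym (lookup-∩ U W q)) h)))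
        (≤-reflexive (#-false (n * t))))
      size-U∪W : size (U ∪ W) ≡ size U + size W
      size-U∪W = trans (sym (+-identityʳ _)) (trans (cong (size (U ∪ W) +_) (sym size-U∩W)) (size-∪-∩ U W))
      U∪W≤2s : size (U ∪ W) ≤ 2 * s
      U∪W≤2s = ≤-trans (≤-reflexive (trans size-U∪W (cong (_+ size W) sizeU))) (<s+<s⇒≤2s U<s size-W<s)
      rich : (D + 1) * size (U ∪ W) < # (N⁺.nbr (U ∪ W))
      rich = ≰⇒> λ po → <⇒≱ (≤-trans (s≤s (m≤n+m (size W) a)) (≤-reflexive (sym (trans size-U∪W (cong (_+ size W) sizeU)))))
        (W-maximal (U ∪ W) (mkBad U∪W≤2s po))
      kept⁺ : Fin n → Bool
      kept⁺ v = not (discarded v) ∧ N⁺.nbr U v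
      cover : ∀ v → N⁺.nbr (U ∪ W) v ≡ true → discarded v ∨ kept⁺ v ≡ true
      cover v h with N⁺.nbr-∪ U W h
      ... | inj₂ y = ∨-intro (inj₁ y)
      ... | inj₁ x with discarded v
      ...   | true = refl
      ...   | false = x
      -- A kept neighbour is reached along a genuine edge or is itself the vertex of a pair in `U`;
      -- the second kind is charged to `size U`.
      split : ∀ v → kept⁺ v ≡ true → free [] U v ∨ N°.nbr U v ≡ true
      split v h with ∧-elim {not (discarded v)} h
      ... | k , h′ with N⁺.nbr-witness U h′
      ... | q , m , a with ∨-elim a
      ... | inj₁ x = ∨-intro (inj₁ (∧-intro k (nbr⇒saturated U v (dec-true (N.nbr? U v) (q , ∧-intro m x)))))
      ... | inj₂ y = ∨-intro {free [] U v} (inj₂ (dec-true (N°.nbr? U v) (q , ∧-intro m y)))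
      kept-split : # kept⁺ ≤ # (free [] U) + # (N°.nbr U)
      kept-split = #-subadd {a = kept⁺} {free [] U} {N°.nbr U} split
    saturated-case : ∀ U q → lookup U q ∧ lookup W q ≡ true → size U ≤ 2 * s → D * size U ≤ Φ [] U
    saturated-case U q h U≤2s = +-cancelˡ-≤ (# discarded) _ _ (begin
      # discarded + D * size U         ≤⟨ +-monoʳ-≤ (# discarded) (*-monoʳ-≤ D U≤2s) ⟩
      # discarded + D * (2 * s)        ≤⟨ m≤m+n _ s ⟩
      # discarded + D * (2 * s) + s    ≤⟨ room-[] ⟩
      n                                ≡⟨ #-true n ⟨
      # {n} (λ _ → true)               ≤⟨ #-subadd {a = λ _ → true} {discarded} {free [] U} pointwise ⟩
      # discarded + # (free [] U)      ≡⟨ cong (# discarded +_) (+-identityʳ _) ⟨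
      # discarded + Φ [] U             ∎)
      where
      u = proj₁ (remQuot {n} t q)
      c = proj₂ (remQuot {n} t q)
      all : ∀ v → N′.nbr U v ≡ true
      all v = N′.nbr-intro U {u} {c} (trans (cong (lookup U) (combine-remQuot {n} t q)) (proj₁ (∧-elim h)))
        (∨-intro (inj₁ (trans (cong (lookup W) (combine-remQuot {n} t q)) (proj₂ (∧-elim {lookup U q} h)))))
      pointwise : ∀ (v : Fin n) → true ≡ true → discarded v ∨ free [] U v ≡ true
      pointwise v _ with discarded v
      ... | true = refl
      ... | false = all v
    expand : ∀ U → size U ≤ 2 * s → D * size U ≤ Φ [] U
    expand U U≤2s with s ≤? size U
    ... | yes s≤U = <⇒≤ (large-slack [] room-[] U s≤U U≤2s)
    ... | no s≰U with any? (λ q → (lookup U q ∧ lookup W q) ≟ᵇ true)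
    ...   | yes (q , h) = saturated-case U q h U≤2s
    ...   | no none = small-case U (≰⇒> s≰U) (λ q h → contradiction (q , h) none)

-- Multiplicities in lists

occ-∉ : ∀ {n} {x : Fin n} {ys} → x ∉ ys → occ x ys ≡ 0
occ-∉ {ys = []} _ = refl
occ-∉ {x = x} {y ∷ ys} x∉ = cong₂ _+_ (cong ⟦_⟧ (dec-false (x ≟ y) (x∉ ∘ here))) (occ-∉ (x∉ ∘ there))

occ-++ : ∀ {n} (x : Fin n) ys zs → occ x (ys ++ zs) ≡ occ x ys + occ x zs
occ-++ x [] zs = refl
occ-++ x (y ∷ ys) zs = trans (cong (⟦ does (x ≟ y) ⟧ +_) (occ-++ x ys zs)) (sym (+-assoc ⟦ does (x ≟ y) ⟧ _ _))

occ-take : ∀ {n} (x : Fin n) r ys → occ x (take r ys) ≤ occ x ys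
occ-take x zero ys = z≤n
occ-take x (suc r) [] = z≤n
occ-take x (suc r) (y ∷ ys) = +-monoʳ-≤ ⟦ does (x ≟ y) ⟧ (occ-take x r ys)

occ-unique : ∀ {n} (x : Fin n) {ys} → Unique ys → occ x ys ≤ 1
occ-unique x [] = z≤n
occ-unique x {y ∷ ys} (y≢ ∷ u) with x ≟ y
... | no _ = occ-unique x u
... | yes refl = ≤-reflexive (cong suc (occ-∉ (λ x∈ → All.lookup y≢ x∈ refl)))

copies : ∀ {A : Set} → ℕ → List A → List A
copies b = concatMap (replicate b)

length-copies : ∀ {A : Set} b (ys : List A) → length (copies b ys) ≡ length ys * b
length-copies b [] = refl
length-copies b (y ∷ ys) = trans (length-++ (replicate b y)) (cong₂ _+_ (length-replicate b) (length-copies b ys))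

occ-copies : ∀ {n} (x : Fin n) b ys → occ x (copies b ys) ≡ occ x ys * b
occ-copies x b [] = refl
occ-copies x b (y ∷ ys) = trans (occ-++ x (replicate b y) (copies b ys))
  (trans (cong₂ _+_ (run b) (occ-copies x b ys)) (sym (*-distribʳ-+ b ⟦ does (x ≟ y) ⟧ _)))
  where
  run : ∀ b → occ x (replicate b y) ≡ ⟦ does (x ≟ y) ⟧ * b
  run zero = sym (*-zeroʳ ⟦ does (x ≟ y) ⟧)
  run (suc b) = trans (cong (⟦ does (x ≟ y) ⟧ +_) (run b)) (sym (*-suc ⟦ does (x ≟ y) ⟧ b))

All-copies : ∀ {A : Set} {P : A → Set} b {ys} → All P ys → All P (copies b ys)
All-copies b ps = All.concat⁺ (All.map⁺ (All.map (All.replicate⁺ b) ps))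

-- Growing and joining trees

module Growth {n t : ℕ} (s D m k : ℕ) (G : GraphFamily n t) (sjoined : SJoined s G)
  (1≤s : 1 ≤ s) (3≤D : 3 ≤ D) (ceil : IsCeilLog (D ∸ 1) s k)
  (adj′ : Fin n → Fin t → Fin n → Bool) (X : Fin n → Bool)
  (joined : ∀ U → s ≤ size U → n < # (Neighbourhood.nbr adj′ U) + s)
  (room : ∀ E → length E ≤ m + 6 * s → Extendability.Room s D adj′ X joined E)
  (sound : ∀ {u c v} → X u ≡ false → adj′ u c v ≡ true → adj (G c) u v ≡ true) where

  open Extendability s D adj′ X joined

  children : List (Edge n t) → List (Fin n)
  children = map proj₂

  child⇒used : ∀ {E w} → w ∈ children E → used E w ≡ true
  child⇒used {e ∷ E} (here refl) = ∨-intro (inj₁ (≟-refl (proj₂ e)))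
  child⇒used {(_ , v) ∷ E} {w} (there w∈) = ∨-intro {does (v ≟ w)} (inj₂ (child⇒used w∈))

  unused⇒∉children : ∀ {E w} → used E w ≡ false → w ∉ children E
  unused⇒∉children fresh w∈ = contradiction (trans (sym (child⇒used w∈)) fresh) λ ()

  unused⇒kept : ∀ E {w} → used E w ≡ false → X w ≡ false
  unused⇒kept [] fresh = fresh
  unused⇒kept ((_ , v) ∷ E) {w} fresh with does (v ≟ w)
  ... | false = unused⇒kept E fresh

  child⇒kept : ∀ {E w} → Valid E → w ∈ children E → X w ≡ false
  child⇒kept {_ ∷ E} ((fresh , _) ∷ _) (here refl) = unused⇒kept E fresh
  child⇒kept (_ ∷ val) (there w∈) = child⇒kept val w∈

  record State (E : List (Edge n t)) : Set where
    constructor mkState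
    field
      valid : Valid E
      ext : Ext E
      closed : All (_∈ children E) (parents E)

  open State

  children-⊆ : ∀ {E E′ w} → E ⊆ E′ → w ∈ children E → w ∈ children E′
  children-⊆ sub = ⊆-lookup (Sublist.map⁺ proj₂ sub)

  childless : ∀ {E w} → State E → w ∉ children E → occ w (parents E) ≡ 0
  childless st w∉ = occ-∉ (λ w∈ → w∉ (All.lookup (closed st) w∈))

  occ≢ : ∀ (x y : Fin n) L → x ≢ y → occ x (y ∷ L) ≡ occ x L
  occ≢ x y L x≢y = cong (λ b → ⟦ b ⟧ + occ x L) (dec-false (x ≟ y) x≢y)

  Budget : ℕ → Set
  Budget r = r ≤ m + 6 * s

  record Sprout (E : List (Edge n t)) (x : Fin n) (c : Fin t) : Set where
    field
      tip : Fin n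
      state : State ((just (x , c) , tip) ∷ E)
      edge : adj (G c) x tip ≡ true
      new : tip ∉ children E
      bare : occ tip (parents ((just (x , c) , tip) ∷ E)) ≡ 0

  sprout : ∀ {E x} c → State E → x ∈ children E → occ x (parents E) < D → Budget (length E) → Sprout E x c
  sprout {E} {x} c st x∈ slack fits
    with extend 1≤s x c (ext st) (room E fits) slack
  ... | w , fresh , a , ext′ = record
    { tip = w
    ; state = mkState ((fresh , λ where refl → a) ∷ valid st) ext′ (there x∈ ∷ All.map there (closed st))
    ; edge = sound (child⇒kept (valid st) x∈) a
    ; new = w∉
    ; bare = trans (occ≢ w x (parents E) (λ where refl → w∉ x∈)) (childless st w∉)
    }
    where
    w∉ : w ∉ children E
    w∉ = unused⇒∉children fresh

  plant : ∀ {E} → State E → Budget (length E) → ∃[ w ] State ((nothing , w) ∷ E)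
  plant {E} st fits with extend-root 1≤s (ext st) (room E fits)
  ... | w , fresh , _ , ext′ = w , mkState ((fresh , λ ()) ∷ valid st) ext′ (All.map there (closed st))

  -- Colours and edges are listed from the tip back to a.
  data Chain (a : Fin n) : List (Fin t) → List (Edge n t) → Fin n → Set where
    []   : Chain a [] [] a
    link : ∀ {c cs P x w} → Chain a cs P x → adj (G c) x w ≡ true → Chain a (c ∷ cs) ((just (x , c) , w) ∷ P) w

  chain-tip : ∀ {a cs P x} E → Chain a cs P x → a ∈ children E → x ∈ children (P ++ E)
  chain-tip E [] a∈ = a∈
  chain-tip E (link _ _) a∈ = here refl

  chain-length : ∀ {a cs P x} → Chain a cs P x → length P ≡ length cs
  chain-length [] = refl
  chain-length (link ch _) = cong suc (chain-length ch)

  chain-closed : ∀ {a cs P x E} → Chain a cs P x → a ∈ children E →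
    All (_∈ children E) (parents E) → All (_∈ children (P ++ E)) (parents (P ++ E))
  chain-closed [] a∈ cl = cl
  chain-closed {E = E} (link ch _) a∈ cl = there (chain-tip E ch a∈) ∷ All.map there (chain-closed ch a∈ cl)

  children-++ʳ : ∀ T {E z} → z ∈ children E → z ∈ children (T ++ E)
  children-++ʳ T = children-⊆ (Sublist.++⁺ˡ T ⊆-refl)

  -- Beyond `a` the chain consists of new vertices, so only its first edge can have an old vertex as
  -- parent.
  chain-occ : ∀ {a cs P x E z} → Chain a cs P x → Valid (P ++ E) → z ∈ children E →
    occ z (parents (P ++ E)) ≤ ⟦ does (z ≟ a) ⟧ + occ z (parents E)
  chain-occ [] val z∈ = m≤n+m _ _
  chain-occ (link [] _) val z∈ = ≤-refl
  chain-occ {E = E} {z} (link {P = R} {x = x} ch@(link {P = P} _ _) _) (_ ∷ val@((fresh , _) ∷ _)) z∈ =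
    ≤-trans (≤-reflexive (occ≢ z x (parents (R ++ E)) λ where refl → unused⇒∉children fresh (children-++ʳ P z∈))) (chain-occ ch val z∈)

  -- The path to `x` is a sublist of `T`, hence in order of insertion, so that discarding the rest
  -- of the tree is an instance of `Ext-mono`.
  Tip : List (Edge n t) → Fin n → List (Fin t) → Fin n → Set
  Tip T a cs x = ∃[ P ] P ⊆ T × Chain a cs P x

  tip-⊆ : ∀ {T T′ a cs x} → T ⊆ T′ → Tip T a cs x → Tip T′ a cs x
  tip-⊆ sub (P , P⊆ , ch) = P , ⊆-trans P⊆ sub , ch

  tip-child : ∀ {T a cs x} E → a ∈ children E → Tip T a cs x → x ∈ children (T ++ E)
  tip-child E a∈ (P , P⊆ , ch) = children-⊆ (Sublist.++⁺ P⊆ ⊆-refl) (chain-tip E ch a∈)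

  -- `Q` is a work list with one entry per child to be created; a vertex that branches is repeated
  -- in it.
  record NewLevel (E T : List (Edge n t)) (a : Fin n) (cs : List (Fin t)) (Q : List (Fin n)) : Set where
    field
      T′ : List (Edge n t)
      A : List (Fin n)
      state : State (T′ ++ E)
      extends : T ⊆ T′
      length-T′ : length T′ ≡ length T + length Q
      length-A : length A ≡ length Q
      tips : All (Tip T′ a cs) A
      unique : Unique A
      new : All (_∉ children (T ++ E)) A
      degrees : ∀ z → occ z (parents (T′ ++ E)) ≤ occ z (parents (T ++ E)) + occ z Q

  newLevel : ∀ {E a cs} c Q T → State (T ++ E) → a ∈ children E → All (Tip T a cs) Q →
    (∀ x → x ∈ Q → occ x (parents (T ++ E)) + occ x Q ≤ D) →
    Budget (length (T ++ E) + length Q) → NewLevel E T a (c ∷ cs) Q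
  newLevel c [] T st a∈ tips slack fits = record
    { T′ = T ; A = [] ; state = st ; extends = ⊆-refl ; length-T′ = sym (+-identityʳ _) ; length-A = refl
    ; tips = [] ; unique = [] ; new = [] ; degrees = λ z → ≤-reflexive (sym (+-identityʳ _)) }
  newLevel {E} {a} {cs} c (q ∷ Q) T st a∈ (tip-q@(P , P⊆ , ch) ∷ tips) slack fits = record
    { T′ = T′
    ; A = w ∷ A
    ; state = state
    ; extends = ⊆-trans (_ ∷ʳ ⊆-refl) extends
    ; length-T′ = trans length-T′ (sym (+-suc (length T) (length Q)))
    ; length-A = cong suc length-A
    ; tips = (_ , ⊆-trans (refl ∷ P⊆) extends , link ch (Sprout.edge sp)) ∷ tips′
    ; unique = All.map (λ x∉ e → x∉ (here (sym e))) new ∷ unique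
    ; new = Sprout.new sp ∷ All.map (λ x∉ → x∉ ∘ there) new
    ; degrees = λ z → ≤-trans (degrees z) (≤-reflexive (shift z))
    }
    where
    shift : ∀ z → (⟦ does (z ≟ q) ⟧ + occ z (parents (T ++ E))) + occ z Q ≡ occ z (parents (T ++ E)) + (⟦ does (z ≟ q) ⟧ + occ z Q)
    shift z = perm ⟦ does (z ≟ q) ⟧ (occ z (parents (T ++ E))) (occ z Q)
      where
      perm : ∀ x y z → (x + y) + z ≡ y + (x + z)
      perm = solve-∀
    sp : Sprout (T ++ E) q c
    sp = sprout c st (tip-child E a∈ tip-q)
      (≤-trans (≤-trans (≤-trans (≤-reflexive (+-comm 1 _)) (+-monoʳ-≤ (occ q (parents (T ++ E))) (≤-trans (≤-reflexive (cong ⟦_⟧ (sym (≟-refl q)))) (m≤m+n _ (occ q Q)))))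
        (slack q (here refl))) ≤-refl)
      (≤-trans (m≤m+n _ _) fits)
    w = Sprout.tip sp
    T₁ = (just (q , c) , w) ∷ T
    open NewLevel (newLevel c Q T₁ (Sprout.state sp) a∈ (All.map (tip-⊆ (_ ∷ʳ ⊆-refl)) tips)
      (λ x x∈ → ≤-trans (≤-reflexive (shift x)) (slack x (there x∈)))
      (≤-trans (≤-reflexive (sym (+-suc (length (T ++ E)) (length Q)))) fits)) renaming (tips to tips′)

  -- The field `quiet` protects the other end of the path: the bush at `a` uses up no degree at any
  -- other vertex of `E`, so a second bush can start there.
  record Bush (E : List (Edge n t)) (a : Fin n) (cs : List (Fin t)) (T : List (Edge n t)) (A : List (Fin n)) : Set where
    field
      state : State (T ++ E)
      tips : All (Tip T a cs) A
      unique : Unique A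
      bare : All (λ x → occ x (parents (T ++ E)) ≡ 0) A
      outside : All (_∉ children E) A
      quiet : ∀ {z} → z ∈ children E → z ≢ a → occ z (parents (T ++ E)) ≤ occ z (parents E)

  open Bush

  -- The branch vertex may already carry other paths and can be asked for one more child only.
  -- Branching starts at the tip, which is bare; the stem also takes up whatever length the half
  -- path has beyond the `k` levels.
  stem : ∀ {E a} c cs → State E → a ∈ children E → occ a (parents E) < D → Budget (length E + length (c ∷ cs)) →
    ∃[ P ] ∃[ x ] Chain a (c ∷ cs) P x × Bush E a (c ∷ cs) P (x ∷ [])
  stem {E} {a} c [] st a∈ slack fits = _ , _ , link [] (Sprout.edge sp) , record
    { state = Sprout.state sp
    ; tips = (_ , ⊆-refl , link [] (Sprout.edge sp)) ∷ []
    ; unique = [] ∷ []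
    ; bare = Sprout.bare sp ∷ []
    ; outside = Sprout.new sp ∷ []
    ; quiet = λ {z} _ z≢a → ≤-reflexive (occ≢ z a (parents E) z≢a)
    }
    where
    sp : Sprout E a c
    sp = sprout c st a∈ slack (≤-trans (m≤m+n _ _) fits)
  stem {E} {a} c (c′ ∷ cs) st a∈ slack fits
    with stem c′ cs st a∈ slack (≤-trans (+-monoʳ-≤ (length E) (n≤1+n _)) fits)
  ... | P , x , ch , bush = _ , _ , link ch (Sprout.edge sp) , record
    { state = Sprout.state sp
    ; tips = (_ , ⊆-refl , link ch (Sprout.edge sp)) ∷ []
    ; unique = [] ∷ []
    ; bare = Sprout.bare sp ∷ []
    ; outside = (Sprout.new sp ∘ children-++ʳ P) ∷ []
    ; quiet = λ {z} z∈ z≢a → ≤-trans (≤-reflexive (occ≢ z x (parents (P ++ E)) λ where refl → All.head (outside bush) z∈)) (quiet bush z∈ z≢a)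
    }
    where
    sp : Sprout (P ++ E) x c
    sp = sprout c (state bush) (chain-tip E ch a∈)
      (≤-trans (s≤s (≤-reflexive (All.head (bare bush)))) (≤-trans (s≤s z≤n) 3≤D))
      (≤-trans (≤-trans (≤-reflexive (trans (length-++ P) (trans (+-comm (length P) _) (cong (length E +_) (chain-length ch)))))
        (+-monoʳ-≤ (length E) (n≤1+n _))) fits)

  b : ℕ
  b = D ∸ 1

  2≤b : 2 ≤ b
  2≤b = ∸-monoˡ-≤ 1 3≤D

  nextLevel : ∀ {E a cs T A} c r → a ∈ children E → Bush E a cs T A → Budget (length (T ++ E) + r) →
    ∃[ T′ ] ∃[ A′ ] Bush E a (c ∷ cs) T′ A′ × length T′ ≤ length T + r × length A′ ≡ r ⊓ (length A * b)
  nextLevel {E} {a} {cs} {T} {A} c r a∈ bush fits = L.T′ , L.A , record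
    { state = L.state
    ; tips = L.tips
    ; unique = L.unique
    ; bare = All.map (λ {w} w∉ → n≤0⇒n≡0 (≤-trans (L.degrees w) (≤-reflexive (cong₂ _+_ (childless (state bush) w∉)
               (occ-∉ (λ w∈Q → w∉ (All.lookup Q-children w∈Q))))))) L.new
    ; outside = All.map (λ x∉ → x∉ ∘ children-++ʳ T) L.new
    ; quiet = λ {z} z∈ z≢a → ≤-trans (L.degrees z) (≤-trans (≤-reflexive (trans (cong (occ z (parents (T ++ E)) +_)
               (occ-∉ (λ z∈Q → All.lookup (Q-all (outside bush)) z∈Q z∈))) (+-identityʳ _))) (quiet bush z∈ z≢a))
    } , ≤-trans (≤-reflexive L.length-T′) (+-monoʳ-≤ (length T) (≤-trans (≤-reflexive length-Q) (m⊓n≤m r _))) ,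
    trans L.length-A length-Q
    where
    Q = take r (copies b A)
    length-Q : length Q ≡ r ⊓ (length A * b)
    length-Q = trans (length-take r (copies b A)) (cong (r ⊓_) (length-copies b A))
    Q-all : ∀ {P : Fin n → Set} → All P A → All P Q
    Q-all ps = All.take⁺ r (All-copies b ps)
    Q-children : All (_∈ children (T ++ E)) Q
    Q-children = Q-all (All.map (tip-child E a∈) (tips bush))
    slack : ∀ x → x ∈ Q → occ x (parents (T ++ E)) + occ x Q ≤ D
    slack x x∈ = begin
      occ x (parents (T ++ E)) + occ x Q   ≡⟨ cong (_+ occ x Q) (All.lookup (Q-all (bare bush)) x∈) ⟩
      occ x Q                              ≤⟨ occ-take x r (copies b A) ⟩
      occ x (copies b A)                   ≡⟨ occ-copies x b A ⟩
      occ x A * b                          ≤⟨ *-monoˡ-≤ b (occ-unique x (unique bush)) ⟩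
      1 * b                                ≡⟨ *-identityˡ b ⟩
      b                                    ≤⟨ m∸n≤m D 1 ⟩
      D                                    ∎
      where open ≤-Reasoning
    module L = NewLevel (newLevel c Q T (state bush) a∈ (Q-all (tips bush)) slack
      (≤-trans (+-monoʳ-≤ (length (T ++ E)) (≤-trans (≤-reflexive length-Q) (m⊓n≤m r _))) fits))

  b^-mono : ∀ j → b ^ j ≤ b ^ suc j
  b^-mono j = ≤-trans (≤-reflexive (sym (*-identityˡ _))) (*-monoˡ-≤ (b ^ j) (≤-trans (s≤s z≤n) 2≤b))

  level-fits : ∀ {E : List (Edge n t)} (T : List (Edge n t)) r {p q} → length T ≤ r + 2 * p → p ≤ s → q ≤ s →
    Budget (length E + r + 3 * s) → Budget (length (T ++ E) + q)
  level-fits {E} T r {p} {q} T≤ p≤s q≤s fits = begin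
    length (T ++ E) + q                  ≡⟨ cong (_+ q) (length-++ T) ⟩
    length T + length E + q              ≤⟨ +-mono-≤ (+-monoˡ-≤ (length E) (≤-trans T≤ (+-monoʳ-≤ r (*-monoʳ-≤ 2 p≤s)))) q≤s ⟩
    (r + 2 * s) + length E + s           ≡⟨ perm r (length E) s ⟩
    length E + r + 3 * s                 ≤⟨ fits ⟩
    m + 6 * s                            ∎
    where
    open ≤-Reasoning
    perm : ∀ r e s → (r + 2 * s) + e + s ≡ e + r + 3 * s
    perm = solve-∀

  -- Level sizes at least double, so a complete bush has fewer than twice as many tree vertices as tips.
  completeBush : ∀ {E a} ds c cs → State E → a ∈ children E → occ a (parents E) < D →
    b ^ length ds ≤ s → Budget (length E + length (c ∷ cs) + 3 * s) →
    ∃[ T ] ∃[ A ] Bush E a (ds ++ c ∷ cs) T A × length A ≡ b ^ length ds ×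
      length T ≤ length (c ∷ cs) + 2 * b ^ length ds
  completeBush [] c cs st a∈ slack _ fits with stem c cs st a∈ slack (≤-trans (m≤m+n _ _) fits)
  ... | P , x , ch , bush = P , x ∷ [] , bush , refl , ≤-trans (≤-reflexive (chain-length ch)) (m≤m+n _ _)
  completeBush {E} {a} (d ∷ ds) c cs st a∈ slack b^≤s fits
    with completeBush ds c cs st a∈ slack (≤-trans (b^-mono (length ds)) b^≤s) fits
  ... | T , A , bush , length-A , T≤
    with nextLevel d (b ^ suc (length ds)) a∈ bush
           (level-fits {E} T (length (c ∷ cs)) T≤ (≤-trans (b^-mono (length ds)) b^≤s) b^≤s fits)
  ... | T′ , A′ , bush′ , T′≤ , length-A′ = T′ , A′ , bush′ , trans length-A′ level-size , total
    where
    open ≤-Reasoning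
    j = length ds
    r = length (c ∷ cs)
    level-size : b ^ suc j ⊓ (length A * b) ≡ b ^ suc j
    level-size = m≤n⇒m⊓n≡m (≤-reflexive (trans (*-comm b _) (cong (_* b) (sym length-A))))
    total : length T′ ≤ r + 2 * b ^ suc j
    total = begin
      length T′                            ≤⟨ T′≤ ⟩
      length T + b ^ suc j                 ≤⟨ +-monoˡ-≤ (b ^ suc j) T≤ ⟩
      r + 2 * b ^ j + b ^ suc j            ≡⟨ +-assoc r _ _ ⟩
      r + (2 * b ^ j + b ^ suc j)          ≤⟨ +-monoʳ-≤ r (+-monoˡ-≤ (b ^ suc j) (*-monoˡ-≤ (b ^ j) 2≤b)) ⟩
      r + (b ^ suc j + b ^ suc j)          ≡⟨ cong (λ z → r + (b ^ suc j + z)) (sym (+-identityʳ _)) ⟩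
      r + 2 * b ^ suc j                    ∎

  -- Minimality of `k`. It keeps every level before the last within `s` vertices.
  b^pred-k≤s : ∀ {j} → suc j ≡ k → b ^ j ≤ s
  b^pred-k≤s {j} refl = <⇒≤ (≰⇒> λ s≤ → contradiction (proj₂ ceil j s≤) (<⇒≱ ≤-refl))

  -- The last level is truncated to s vertices, which keeps the whole tree below 3s.
  wideBush : ∀ {E a} ds c cs → length ds ≡ k → State E → a ∈ children E → occ a (parents E) < D →
    Budget (length E + length (c ∷ cs) + 3 * s) →
    ∃[ T ] ∃[ A ] Bush E a (ds ++ c ∷ cs) T A × s ≤ length A × length T ≤ length (c ∷ cs) + 3 * s
  -- Here `k` is 0, so `ceil` gives `s ≤ 1` and the tip of the stem alone is wide enough.
  wideBush {E} {a} [] c cs refl st a∈ slack fits with stem c cs st a∈ slack (≤-trans (m≤m+n _ _) fits)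
  ... | P , x , ch , bush = P , x ∷ [] , bush , proj₁ ceil , ≤-trans (≤-reflexive (chain-length ch)) (m≤m+n _ _)
  wideBush {E} {a} (d ∷ ds) c cs ds≡k st a∈ slack fits
    with completeBush ds c cs st a∈ slack (b^pred-k≤s ds≡k) fits
  ... | T , A , bush , length-A , T≤
    with nextLevel d s a∈ bush (level-fits {E} T (length (c ∷ cs)) T≤ (b^pred-k≤s ds≡k) ≤-refl fits)
  ... | T′ , A′ , bush′ , T′≤ , length-A′ = T′ , A′ , bush′ , ≤-reflexive (sym (trans length-A′ (m≤n⇒m⊓n≡m s≤))) , total
    where
    open ≤-Reasoning
    r = length (c ∷ cs)
    perm : ∀ r s → r + 2 * s + s ≡ r + 3 * s
    perm = solve-∀
    s≤ : s ≤ length A * b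
    s≤ = ≤-trans (subst (λ z → s ≤ b ^ z) (sym ds≡k) (proj₁ ceil))
      (≤-reflexive (trans (*-comm b _) (cong (_* b) (sym length-A))))
    total : length T′ ≤ r + 3 * s
    total = begin
      length T′               ≤⟨ T′≤ ⟩
      length T + s            ≤⟨ +-monoˡ-≤ s (≤-trans T≤ (+-monoʳ-≤ r (*-monoʳ-≤ 2 (b^pred-k≤s ds≡k)))) ⟩
      r + 2 * s + s           ≡⟨ perm r s ⟩
      r + 3 * s               ∎

  -- Joining two branch vertices

  record Connection (E : List (Edge n t)) (a a′ : Fin n) (cs : List (Fin t)) (c : Fin t) (cs′ : List (Fin t)) : Set where
    field
      {P P′} : List (Edge n t)
      {x x′} : Fin n
      chain : Chain a cs P x
      chain′ : Chain a′ cs′ P′ x′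
      bridge : adj (G c) x x′ ≡ true
      state : State (P′ ++ P ++ E)
      degrees : ∀ {z} → z ∈ children E →
        occ z (parents (P′ ++ P ++ E)) ≤ ⟦ does (z ≟ a′) ⟧ + (⟦ does (z ≟ a) ⟧ + occ z (parents E))

  -- The second bush is grown while the whole first one is in place, which makes them disjoint; this
  -- is why `6 * s` vertices beyond the final ones are budgeted.
  connect : ∀ {E a a′} ds e cs c ds′ e′ cs′ → length ds ≡ k → length ds′ ≡ k → State E →
    a ∈ children E → a′ ∈ children E → a ≢ a′ → occ a (parents E) < D → occ a′ (parents E) < D →
    length E + length (e ∷ cs) + length (e′ ∷ cs′) ≤ m →
    Connection E a a′ (ds ++ e ∷ cs) c (ds′ ++ e′ ∷ cs′)
  connect {E} {a} {a′} ds e cs c ds′ e′ cs′ ds≡k ds′≡k st a∈ a′∈ a≢a′ slack slack′ fits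
    with wideBush ds e cs ds≡k st a∈ slack fits₁
    where
    open ≤-Reasoning
    fits₁ : Budget (length E + length (e ∷ cs) + 3 * s)
    fits₁ = +-mono-≤ {length E + length (e ∷ cs)} {m} {3 * s} {6 * s} (≤-trans (m≤m+n _ (length (e′ ∷ cs′))) fits) (*-monoˡ-≤ s {3} {6} (s≤s (s≤s (s≤s z≤n))))
  ... | T , A , bush , s≤A , T≤
    with wideBush ds′ e′ cs′ ds′≡k (state bush) (children-++ʳ T a′∈)
           (≤-trans (s≤s (quiet bush a′∈ (a≢a′ ∘ sym))) slack′) fits₂
    where
    open ≤-Reasoning
    perm : ∀ r r′ e s → r + 3 * s + e + r′ + 3 * s ≡ (e + r + r′) + 6 * s
    perm = solve-∀
    fits₂ : Budget (length (T ++ E) + length (e′ ∷ cs′) + 3 * s)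
    fits₂ = begin
      length (T ++ E) + length (e′ ∷ cs′) + 3 * s                           ≡⟨ cong (λ z → z + length (e′ ∷ cs′) + 3 * s) (length-++ T) ⟩
      length T + length E + length (e′ ∷ cs′) + 3 * s                       ≤⟨ +-monoˡ-≤ (3 * s) (+-monoˡ-≤ (length (e′ ∷ cs′)) (+-monoˡ-≤ (length E) T≤)) ⟩
      length (e ∷ cs) + 3 * s + length E + length (e′ ∷ cs′) + 3 * s        ≡⟨ perm (length (e ∷ cs)) (length (e′ ∷ cs′)) (length E) s ⟩
      (length E + length (e ∷ cs) + length (e′ ∷ cs′)) + 6 * s              ≤⟨ +-monoˡ-≤ (6 * s) fits ⟩
      m + 6 * s                                                             ∎
  ... | T′ , A′ , bush′ , s≤A′ , T′≤
    -- Pairing all leaves of the first bush with the one colour `c` forces the edge obtained from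
    -- joinedness to have the colour of the middle edge.
    with sjoined (map (_, c) A) A′ (map⁺ (cong proj₁) (unique bush)) (unique bush′)
           (≤-trans s≤A (≤-reflexive (sym (length-map _ A)))) s≤A′
  ... | u , i , x′ , ui∈ , x′∈ , uv with ∈-map⁻ (_, c) ui∈
  ... | x , x∈ , refl with All.lookup (tips bush) x∈ | All.lookup (tips bush′) x′∈
  ... | P , P⊆ , ch | P′ , P′⊆ , ch′ = record
    { chain = ch
    ; chain′ = ch′
    ; bridge = uv
    ; state = mkState val (Ext-mono sub (valid (state bush′)) (ext (state bush′)))
        (chain-closed ch′ (children-++ʳ P a′∈) (chain-closed ch a∈ (closed st)))
    ; degrees = λ {z} z∈ → ≤-trans (chain-occ ch′ val (children-++ʳ P z∈))
        (+-monoʳ-≤ ⟦ does (z ≟ a′) ⟧ (chain-occ ch (Valid-mono (Sublist.++⁺ˡ P′ ⊆-refl) val) z∈))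
    }
    where
    sub : P′ ++ P ++ E ⊆ T′ ++ T ++ E
    sub = Sublist.++⁺ P′⊆ (Sublist.++⁺ P⊆ ⊆-refl)
    val : Valid (P′ ++ P ++ E)
    val = Valid-mono sub (valid (state bush′))

-- Lists

private
  variable
    A B : Set

lookup-unique-injective : {xs : List A} → Unique xs → ∀ {i j} → lookupᴸ xs i ≡ lookupᴸ xs j → i ≡ j
lookup-unique-injective (_ ∷ _) {zero} {zero} _ = refl
lookup-unique-injective (x≢ ∷ _) {zero} {suc j} e = contradiction e (All.lookup x≢ (∈-lookup j))
lookup-unique-injective (x≢ ∷ _) {suc i} {zero} e = contradiction (sym e) (All.lookup x≢ (∈-lookup i))
lookup-unique-injective (_ ∷ u) {suc i} {suc j} e = cong suc (lookup-unique-injective u e)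

unique-length : ∀ {N} {xs : List (Fin N)} → Unique xs → length xs ≤ N
unique-length u = injective⇒≤ (lookup-unique-injective u)

unique-map-injective : (f : A → B) {xs : List A} → Unique (map f xs) → ∀ {x y} → x ∈ xs → y ∈ xs → f x ≡ f y → x ≡ y
unique-map-injective f (_ ∷ _) (here refl) (here refl) _ = refl
unique-map-injective f (x≢ ∷ _) (here refl) (there y∈) e = contradiction e (All.lookup x≢ (∈-map⁺ f y∈))
unique-map-injective f (x≢ ∷ _) (there x∈) (here refl) e = contradiction (sym e) (All.lookup x≢ (∈-map⁺ f x∈))
unique-map-injective f (_ ∷ u) (there x∈) (there y∈) e = unique-map-injective f u x∈ y∈ e

unique-resp-↭ : {xs ys : List A} → xs ↭ ys → Unique xs → Unique ys
unique-resp-↭ {A} p = PermutationSetoid.Unique-resp-↭ (setoid A) (↭⇒↭ₛ p)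

map-proj₁-zip : (xs : List A) (ys : List B) → length xs ≡ length ys → map proj₁ (zip xs ys) ≡ xs
map-proj₁-zip [] [] _ = refl
map-proj₁-zip (x ∷ xs) (y ∷ ys) e = cong (x ∷_) (map-proj₁-zip xs ys (suc-injective e))

map-proj₂-zip : (xs : List A) (ys : List B) → length xs ≡ length ys → map proj₂ (zip xs ys) ≡ ys
map-proj₂-zip [] [] _ = refl
map-proj₂-zip (x ∷ xs) (y ∷ ys) e = cong (y ∷_) (map-proj₂-zip xs ys (suc-injective e))

∈-zip-∷ʳ : (xs : List A) (ys : List B) → length xs ≡ length ys → ∀ {x y p} →
  p ∈ zip (xs ++ x ∷ []) (ys ++ y ∷ []) → p ∈ zip xs ys ⊎ p ≡ (x , y)
∈-zip-∷ʳ [] [] _ (here refl) = inj₂ refl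
∈-zip-∷ʳ (_ ∷ xs) (_ ∷ ys) e (here refl) = inj₁ (here refl)
∈-zip-∷ʳ (_ ∷ xs) (_ ∷ ys) e (there p∈) with ∈-zip-∷ʳ xs ys (suc-injective e) p∈
... | inj₁ q = inj₁ (there q)
... | inj₂ q = inj₂ q

module _ {R : A → A → Set} where

  linked-consecutive : ∀ pre {x y suf} → Linked R (pre ++ x ∷ y ∷ suf) → R x y
  linked-consecutive [] (r ∷ _) = r
  linked-consecutive (_ ∷ []) (_ ∷ l) = linked-consecutive [] l
  linked-consecutive (_ ∷ p ∷ pre) (_ ∷ l) = linked-consecutive (p ∷ pre) l

  linked-ʳ++⁺ : Symmetric R → ∀ {x xs ys} → Linked R (x ∷ xs) → Linked R (x ∷ ys) → Linked R (xs ʳ++ x ∷ ys)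
  linked-ʳ++⁺ R-sym [-] l = l
  linked-ʳ++⁺ R-sym (r ∷ k) l = linked-ʳ++⁺ R-sym k (R-sym r ∷ l)

  linked-ʳ++⁻ : Symmetric R → ∀ {x} xs {ys} → Linked R (xs ʳ++ x ∷ ys) → Linked R (x ∷ xs) × Linked R (x ∷ ys)
  linked-ʳ++⁻ R-sym [] l = [-] , l
  linked-ʳ++⁻ R-sym (y ∷ xs) l with linked-ʳ++⁻ R-sym xs l
  ... | k , (r ∷ l′) = R-sym r ∷ k , l′

-- A list cut in two is represented by its reversed front and its back.
move-cut : ∀ j (x : A) xs ys → j ≤ length ys → ∃[ x′ ] ∃[ xs′ ] ∃[ ys′ ]
  (x ∷ xs) ʳ++ ys ≡ (x′ ∷ xs′) ʳ++ ys′ × length xs′ ≡ length xs + j × length ys′ + j ≡ length ys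
move-cut zero x xs ys _ = x , xs , ys , refl , sym (+-identityʳ _) , +-identityʳ _
move-cut (suc j) x xs (y ∷ ys) (s≤s h) with move-cut j y (x ∷ xs) ys h
... | x′ , xs′ , ys′ , e , lx , ly = x′ , xs′ , ys′ , e , trans lx (sym (+-suc (length xs) j)) , trans (+-suc _ j) (cong suc ly)

cut-at : ∀ j (zs : List A) → suc (suc j) ≤ length zs → ∃[ x ] ∃[ xs ] ∃[ y ] ∃[ ys ]
  zs ≡ (x ∷ xs) ʳ++ (y ∷ ys) × length xs ≡ j × suc (length ys) + suc j ≡ length zs
cut-at j (z ∷ zs) (s≤s h) with move-cut j z [] zs (≤-trans (n≤1+n j) h)
... | x , xs , [] , e , lx , ly = contradiction h (<⇒≱ (s≤s (≤-reflexive (sym ly))))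
... | x , xs , y ∷ ys , e , lx , ly = x , xs , y , ys , e , lx , trans (+-suc (suc (length ys)) j) (cong suc ly)

ʳ++-++-assoc : (xs ys zs : List A) → (xs ʳ++ ys) ++ zs ≡ xs ʳ++ (ys ++ zs)
ʳ++-++-assoc [] ys zs = refl
ʳ++-++-assoc (x ∷ xs) ys zs = ʳ++-++-assoc xs (x ∷ ys) zs

ʳ++↭ : (xs ys : List A) → xs ʳ++ ys ↭ ys ++ xs
ʳ++↭ xs ys = ↭-trans (↭-reflexive (ʳ++-defn xs)) (↭-trans (↭-++⁺ʳ ys (↭-reverse xs)) (++-comm xs ys))

split-colours : ∀ k (cs : List A) → k < length cs → ∃[ ds ] ∃[ e ] ∃[ es ] cs ≡ ds ++ e ∷ es × length ds ≡ k
split-colours zero (c ∷ cs) _ = [] , c , cs , refl , refl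
split-colours (suc k) (c ∷ cs) (s≤s h) with split-colours k cs h
... | ds , e , es , eq , len = c ∷ ds , e , es , cong (c ∷_) eq , cong suc len

-- The degree of `l` in the graph of branch pairs joined so far; it bounds the number of children at
-- the image of branch `l`.
deg : ∀ {D} → Fin D → List (Fin D × Fin D) → ℕ
deg l [] = 0
deg l ((i , j) ∷ L) = ⟦ does (l ≟ j) ⟧ + (⟦ does (l ≟ i) ⟧ + deg l L)

-- The orientation of the pairs makes the opposite ends distinct: `(l , o)` and `(o , l)` cannot
-- both be increasing.
opposites : ∀ {D} (l : Fin D) L → Unique L → All (λ p → proj₁ p <ᶠ proj₂ p) L →
  ∃[ O ] Unique O × length O ≡ deg l L × (∀ {o} → o ∈ O → (l , o) ∈ L ⊎ (o , l) ∈ L)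
opposites l [] _ _ = [] , [] , refl , λ ()
opposites l ((i , j) ∷ L) (p∉ ∷ u) (i<j ∷ lt) with opposites l L u lt
... | O , uO , lenO , sub with l ≟ j | l ≟ i
...   | yes refl | yes refl = contradiction refl (<⇒≢ i<j)
...   | no _ | no _ = O , uO , lenO , λ o∈ → [ inj₁ ∘ there , inj₂ ∘ there ]′ (sub o∈)
...   | yes refl | no _ = i ∷ O , All.tabulate (λ {o} o∈ → fresh o (sub o∈)) ∷ uO , cong suc lenO , λ where
          (here refl) → inj₂ (here refl)
          (there o∈) → [ inj₁ ∘ there , inj₂ ∘ there ]′ (sub o∈)
  where
  fresh : ∀ o → (j , o) ∈ L ⊎ (o , j) ∈ L → i ≢ o
  fresh o (inj₁ m) refl = <-asym i<j (All.lookup lt m)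
  fresh o (inj₂ m) refl = All.lookup p∉ m refl
...   | no _ | yes refl = j ∷ O , All.tabulate (λ {o} o∈ → fresh o (sub o∈)) ∷ uO , cong suc lenO , λ where
          (here refl) → inj₁ (here refl)
          (there o∈) → [ inj₁ ∘ there , inj₂ ∘ there ]′ (sub o∈)
  where
  fresh : ∀ o → (i , o) ∈ L ⊎ (o , i) ∈ L → j ≢ o
  fresh o (inj₂ m) refl = <-asym i<j (All.lookup lt m)
  fresh o (inj₁ m) refl = All.lookup p∉ m refl

deg≤D : ∀ {D} (l : Fin D) {L} → Unique L → All (λ p → proj₁ p <ᶠ proj₂ p) L → deg l L ≤ D
deg≤D l {L} u lt with opposites l L u lt
... | O , uO , lenO , _ = ≤-trans (≤-reflexive (sym lenO)) (unique-length uO)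

-- Embedding the subdivision

module Embedding {n t : ℕ} (s D m k : ℕ) (G : GraphFamily n t) (sjoined : SJoined s G)
  (1≤s : 1 ≤ s) (3≤D : 3 ≤ D) (ceil : IsCeilLog (D ∸ 1) s k)
  (adj′ : Fin n → Fin t → Fin n → Bool) (X : Fin n → Bool)
  (joined : ∀ U → s ≤ size U → n < # (Neighbourhood.nbr adj′ U) + s)
  (room : ∀ E → length E ≤ m + 6 * s → Extendability.Room s D adj′ X joined E)
  (sound : ∀ {u c v} → X u ≡ false → adj′ u c v ≡ true → adj (G c) u v ≡ true)
  (ext-[] : Extendability.Ext s D adj′ X joined [])
  (H : ColoredGraph m t) (subdivision : SubdivisionOfK H D (2 * k + 3)) where

  open Extendability s D adj′ X joined
  open Growth s D m k G sjoined 1≤s 3≤D ceil adj′ X joined room sound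
  open SubdivisionOfK subdivision

  Placement : Set
  Placement = List (Fin m × Fin n)

  -- Images are referred to by membership in `M`, so a realized edge remains realized when `M`
  -- grows.
  Realized : Placement → Fin m → Fin m → Set
  Realized M u v = ∀ c → col H u v ≡ just c → ∃[ u′ ] ∃[ v′ ] (u , u′) ∈ M × (v , v′) ∈ M × adj (G c) u′ v′ ≡ true

  Realized-sym : ∀ M → Symmetric (Realized M)
  Realized-sym M {u} {v} r c e with r c (trans (csym H u v) e)
  ... | u′ , v′ , u∈ , v∈ , a = v′ , u′ , v∈ , u∈ , trans (SimpleGraph.sym (G c) v′ u′) a

  IsEdge-sym : Symmetric (IsEdge H)
  IsEdge-sym {u} {v} e = subst Is-just (csym H u v) e

  just-of : {x : Maybe (Fin t)} → Is-just x → ∃[ c ] x ≡ just c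
  just-of (just {x = c} _) = c , refl

  data Walk : Fin m → List (Fin m) → List (Fin t) → Set where
    []   : ∀ {y} → Walk y [] []
    step : ∀ {y y′ zs c cs} → col H y′ y ≡ just c → Walk y zs cs → Walk y′ (y ∷ zs) (c ∷ cs)

  colours : ∀ {y zs} → Linked (IsEdge H) (y ∷ zs) → ∃[ cs ] Walk y zs cs × length cs ≡ length zs
  colours [-] = [] , [] , refl
  colours (e ∷ l) with just-of e | colours l
  ... | c , eq | cs , w , len = c ∷ cs , step eq w , cong suc len

  -- `Walk` and `Chain` both run from the cut back to the branch vertex, so the half path matches
  -- the children of `P` in order, with `a` at the end.
  realize : ∀ {M y zs cs a P x} → Walk y zs cs → Chain a cs P x →
    (∀ {p} → p ∈ zip (y ∷ zs) (children P ++ a ∷ []) → p ∈ M) →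
    Linked (Realized M) (y ∷ zs) × (y , x) ∈ M
  realize [] [] sub = [-] , sub (here refl)
  realize {M} (step {y} {y′} e w) (link {c} {x = x} {w = v} ch a) sub with realize w ch (sub ∘ there)
  ... | l , y∈ = edge ∷ l , sub (here refl)
    where
    edge : Realized M y′ y
    edge c′ e′ with trans (sym e) e′
    ... | refl = v , x , sub (here refl) , y∈ , trans (SimpleGraph.sym (G c) v x) a

  children-unique : ∀ {E} → Valid E → Unique (children E)
  children-unique [] = []
  children-unique {(_ , w) ∷ E} ((fresh , _) ∷ val) =
    All.tabulate (λ v∈ e → unused⇒∉children fresh (subst (_∈ children E) (sym e) v∈)) ∷ children-unique val

  -- By `images`, the placement lists its images in the order of the forest, so validity of the
  -- forest yields injectivity and the forest has exactly one edge per placed vertex. The field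
  -- `only` guarantees that the inner vertices of the next path are not yet placed.
  record Partial (L : List (Fin D × Fin D)) : Set where
    field
      E : List (Edge n t)
      M : Placement
      state : State E
      images : map proj₂ M ≡ children E
      distinct : Unique (map proj₁ M)
      branches : ∀ i → branch i ∈ map proj₁ M
      inners : ∀ {i j x} → (i , j) ∈ L → x ∈ inner i j → x ∈ map proj₁ M
      only : ∀ {x} → x ∈ map proj₁ M → (∃[ i ] branch i ≡ x) ⊎ (∃[ i ] ∃[ j ] (i , j) ∈ L × x ∈ inner i j)
      done : ∀ {i j} → (i , j) ∈ L → Linked (Realized M) (fullPath i j)
      degrees : ∀ {i v} → (branch i , v) ∈ M → occ v (parents E) ≤ deg i L

    place : ∀ {x} → x ∈ map proj₁ M → ∃[ v ] (x , v) ∈ M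
    place x∈ with ∈-map⁻ proj₁ x∈
    ... | (_ , v) , p∈ , refl = v , p∈

    functional : ∀ {x v v′} → (x , v) ∈ M → (x , v′) ∈ M → v ≡ v′
    functional p q = cong proj₂ (unique-map-injective proj₁ distinct p q refl)

    injective : ∀ {x x′ v} → (x , v) ∈ M → (x′ , v) ∈ M → x ≡ x′
    injective p q = cong proj₁ (unique-map-injective proj₂
      (subst Unique (sym images) (children-unique (State.valid state))) p q refl)

    image-child : ∀ {x v} → (x , v) ∈ M → v ∈ children E
    image-child p = subst (_ ∈_) images (∈-map⁺ proj₂ p)

  plantAll : ∀ r → r ≤ m + 6 * s → ∃[ E ] State E × length E ≡ r × parents E ≡ []
  plantAll zero _ = [] , mkState [] ext-[] [] , refl , refl
  plantAll (suc r) h with plantAll r (≤-trans (n≤1+n r) h)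
  ... | E , st , len , par with plant st (≤-trans (≤-reflexive len) (≤-trans (n≤1+n r) h))
  ...   | w , st′ = (nothing , w) ∷ E , st′ , cong suc len , par

  start : Partial []
  start = record
    { E = E
    ; M = M
    ; state = proj₁ (proj₂ planted)
    ; images = map-proj₂-zip bs (children E) lens
    ; distinct = subst Unique (sym dom) bs-unique
    ; branches = λ i → subst (branch i ∈_) (sym dom) (∈-map⁺ branch (∈-allFin i))
    ; inners = λ ()
    ; only = λ {x} x∈ → inj₁ (back (subst (x ∈_) dom x∈))
    ; done = λ ()
    ; degrees = λ {_} {v} _ → ≤-reflexive (cong (occ v) (proj₂ (proj₂ (proj₂ planted))))
    }
    where
    bs : List (Fin m)
    bs = map branch (allFin D)
    bs-unique : Unique bs
    bs-unique = map⁺ branchInj (allFin⁺ D)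
    planted = plantAll (length bs) (≤-trans (unique-length bs-unique) (m≤m+n m _))
    E = proj₁ planted
    M = zip bs (children E)
    lens : length bs ≡ length (children E)
    lens = sym (trans (length-map proj₂ E) (proj₁ (proj₂ (proj₂ planted))))
    dom : map proj₁ M ≡ bs
    dom = map-proj₁-zip bs (children E) lens
    back : ∀ {x} → x ∈ bs → ∃[ i ] branch i ≡ x
    back x∈ with ∈-map⁻ branch x∈
    ... | i , _ , e = i , sym e

  length-∷ʳ : ∀ (xs : List A) {y} → length (xs ++ y ∷ []) ≡ suc (length xs)
  length-∷ʳ xs = trans (length-++ xs) (+-comm _ 1)

  -- Attaching one path to a partial embedding

  module Attach {i j L} (i<j : i <ᶠ j) (ij∉ : (i , j) ∉ L) (lt : All (λ p → proj₁ p <ᶠ proj₂ p) L)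
    (part : Partial L) {r rs z zs} (inner≡ : inner i j ≡ (r ∷ rs) ʳ++ (z ∷ zs)) where

    open Partial part

    back front : List (Fin m)
    back = rs ++ branch i ∷ []
    front = zs ++ branch j ∷ []

    path≡ : fullPath i j ≡ (r ∷ back) ʳ++ (z ∷ front)
    path≡ = trans (cong (λ ys → branch i ∷ (ys ++ branch j ∷ [])) inner≡)
      (trans (cong (branch i ∷_) (ʳ++-++-assoc (r ∷ rs) (z ∷ zs) (branch j ∷ []))) (sym (++-ʳ++ (r ∷ rs))))

    halves : Linked (IsEdge H) (r ∷ back) × Linked (IsEdge H) (r ∷ z ∷ front)
    halves = linked-ʳ++⁻ (λ {u} {v} → IsEdge-sym {u} {v}) back (subst (Linked (IsEdge H)) path≡ (isPath i j i<j))

    dom′ : List (Fin m)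
    dom′ = (z ∷ zs) ++ (r ∷ rs) ++ map proj₁ M

    inner+dom↭dom′ : inner i j ++ map proj₁ M ↭ dom′
    inner+dom↭dom′ = ↭-trans (↭-++⁺ʳ (map proj₁ M) (↭-trans (↭-reflexive inner≡) (ʳ++↭ (r ∷ rs) (z ∷ zs))))
      (↭-reflexive (++-assoc (z ∷ zs) (r ∷ rs) (map proj₁ M)))

    inner-fresh : ∀ {x} → ¬ (x ∈ inner i j × x ∈ map proj₁ M)
    inner-fresh {x} (x∈ , x∈M) with only x∈M
    ... | inj₁ (l , e) = innerNotBranch i j i<j x x∈ l e
    ... | inj₂ (i′ , j′ , ij′∈ , x∈′) = innerDisjoint i j i′ j′ i<j (All.lookup lt ij′∈)
            (λ where (refl , refl) → ij∉ ij′∈) x x∈ x∈′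

    dom′-unique : Unique dom′
    dom′-unique = unique-resp-↭ inner+dom↭dom′ (++⁺ (innerUnique i j i<j) distinct inner-fresh)

    length-E : length E ≡ length (map proj₁ M)
    length-E = trans (sym (length-map proj₂ E)) (trans (cong length (sym images)) (trans (length-map proj₂ M) (sym (length-map proj₁ M))))

    -- The count is made in `H`: the placed vertices and the inner vertices of the new path are
    -- distinct, so there are at most `m` of them.
    fits : length E + suc (length rs) + suc (length zs) ≤ m
    fits = begin
      length E + suc (length rs) + suc (length zs)                    ≡⟨ cong (λ x → x + suc (length rs) + suc (length zs)) length-E ⟩
      length (map proj₁ M) + suc (length rs) + suc (length zs)        ≡⟨ perm (length (map proj₁ M)) (suc (length rs)) (suc (length zs)) ⟩
      suc (length zs) + (suc (length rs) + length (map proj₁ M))      ≡⟨ cong (suc (length zs) +_) (length-++ (r ∷ rs)) ⟨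
      suc (length zs) + length ((r ∷ rs) ++ map proj₁ M)              ≡⟨ length-++ (z ∷ zs) ⟨
      length dom′                                                     ≤⟨ unique-length dom′-unique ⟩
      m                                                               ∎
      where
      open ≤-Reasoning
      perm : ∀ x y w → x + y + w ≡ w + (y + x)
      perm = solve-∀

    connection : ∀ {a a′ cs cs′} c₀ → (branch i , a) ∈ M → (branch j , a′) ∈ M →
      length cs ≡ suc (length rs) → length cs′ ≡ suc (length zs) → k < length cs → k < length cs′ →
      deg i L < D → deg j L < D → Connection E a a′ cs c₀ cs′
    connection {a} {a′} {cs} {cs′} c₀ a-at a′-at len len′ k<cs k<cs′ slack slack′
      with split-colours k cs k<cs | split-colours k cs′ k<cs′
    ... | ds , e , es , refl , len-ds | ds′ , e′ , es′ , refl , len-ds′ =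
      connect ds e es c₀ ds′ e′ es′ len-ds len-ds′ state (image-child a-at) (image-child a′-at) a≢a′
        (≤-trans (s≤s (degrees a-at)) slack) (≤-trans (s≤s (degrees a′-at)) slack′)
        (≤-trans (+-mono-≤ (+-monoʳ-≤ (length E) (suffix≤ ds len)) (suffix≤ ds′ len′)) fits)
      where
      a≢a′ : a ≢ a′
      a≢a′ refl = <⇒≢ i<j (branchInj (injective a-at a′-at))
      suffix≤ : ∀ (ds : List (Fin t)) {es l} → length (ds ++ es) ≡ l → length es ≤ l
      suffix≤ ds refl = ≤-trans (m≤n+m _ (length ds)) (≤-reflexive (sym (length-++ ds)))

    install : ∀ {a a′ cs cs′ c₀} → (branch i , a) ∈ M → (branch j , a′) ∈ M →
      Walk r back cs → Walk z front cs′ → col H r z ≡ just c₀ →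
      length cs ≡ suc (length rs) → length cs′ ≡ suc (length zs) →
      Connection E a a′ cs c₀ cs′ → Partial ((i , j) ∷ L)
    install {a} {a′} a-at a′-at walk walk′ rz len len′ con = record
      { E = C.P′ ++ C.P ++ E
      ; M = M′
      ; state = C.state
      ; images = images′
      ; distinct = subst Unique (sym dom) dom′-unique
      ; branches = λ l → old-dom (branches l)
      ; inners = λ where
          (here refl) x∈ → new-dom x∈
          (there ij∈) x∈ → old-dom (inners ij∈ x∈)
      ; only = only′
      ; done = λ where
          (here refl) → path-done
          (there ij∈) → Linked.map (λ {u} {v} → still-realized {u} {v}) (done ij∈)
      ; degrees = degrees′
      }
      where
      module C = Connection con
      lens : length (r ∷ rs) ≡ length (children C.P)
      lens = trans (sym len) (trans (sym (chain-length C.chain)) (sym (length-map proj₂ C.P)))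
      lens′ : length (z ∷ zs) ≡ length (children C.P′)
      lens′ = trans (sym len′) (trans (sym (chain-length C.chain′)) (sym (length-map proj₂ C.P′)))
      M₁ M₂ M′ : Placement
      M₁ = zip (r ∷ rs) (children C.P)
      M₂ = zip (z ∷ zs) (children C.P′)
      M′ = M₂ ++ M₁ ++ M
      old : ∀ {p} → p ∈ M → p ∈ M′
      old p∈ = ∈-++⁺ʳ M₂ (∈-++⁺ʳ M₁ p∈)
      still-realized : ∀ {u v} → Realized M u v → Realized M′ u v
      still-realized re c e with re c e
      ... | u′ , v′ , u∈ , v∈ , ad = u′ , v′ , old u∈ , old v∈ , ad
      dom : map proj₁ M′ ≡ dom′
      dom = trans (map-++ proj₁ M₂ (M₁ ++ M)) (cong₂ _++_ (map-proj₁-zip (z ∷ zs) _ lens′)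
        (trans (map-++ proj₁ M₁ M) (cong (_++ map proj₁ M) (map-proj₁-zip (r ∷ rs) _ lens))))
      images′ : map proj₂ M′ ≡ children (C.P′ ++ C.P ++ E)
      images′ = trans (map-++ proj₂ M₂ (M₁ ++ M)) (trans (cong₂ _++_ (map-proj₂-zip (z ∷ zs) _ lens′)
        (trans (map-++ proj₂ M₁ M) (trans (cong₂ _++_ (map-proj₂-zip (r ∷ rs) _ lens) images) (sym (map-++ proj₂ C.P E)))))
        (sym (map-++ proj₂ C.P′ (C.P ++ E))))
      old-dom : ∀ {x} → x ∈ map proj₁ M → x ∈ map proj₁ M′
      old-dom {x} x∈ = subst (x ∈_) (sym dom) (∈-++⁺ʳ (z ∷ zs) (∈-++⁺ʳ (r ∷ rs) x∈))
      new-dom : ∀ {x} → x ∈ inner i j → x ∈ map proj₁ M′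
      new-dom {x} x∈ = subst (x ∈_) (sym dom) (∈-resp-↭ inner+dom↭dom′ (∈-++⁺ˡ x∈))
      only′ : ∀ {x} → x ∈ map proj₁ M′ →
        (∃[ l ] branch l ≡ x) ⊎ (∃[ i′ ] ∃[ j′ ] (i′ , j′) ∈ (i , j) ∷ L × x ∈ inner i′ j′)
      only′ {x} x∈ with ∈-++⁻ (inner i j) (∈-resp-↭ (↭-sym inner+dom↭dom′) (subst (x ∈_) dom x∈))
      ... | inj₁ x∈inner = inj₂ (i , j , here refl , x∈inner)
      ... | inj₂ x∈M with only x∈M
      ...   | inj₁ b = inj₁ b
      ...   | inj₂ (i′ , j′ , ij∈ , x∈′) = inj₂ (i′ , j′ , there ij∈ , x∈′)
      sub₁ : ∀ {p} → p ∈ zip (r ∷ back) (children C.P ++ a ∷ []) → p ∈ M′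
      sub₁ p∈ with ∈-zip-∷ʳ (r ∷ rs) (children C.P) lens p∈
      ... | inj₁ q = ∈-++⁺ʳ M₂ (∈-++⁺ˡ q)
      ... | inj₂ refl = old a-at
      sub₂ : ∀ {p} → p ∈ zip (z ∷ front) (children C.P′ ++ a′ ∷ []) → p ∈ M′
      sub₂ p∈ with ∈-zip-∷ʳ (z ∷ zs) (children C.P′) lens′ p∈
      ... | inj₁ q = ∈-++⁺ˡ q
      ... | inj₂ refl = old a′-at
      half : Linked (Realized M′) (r ∷ back) × (r , C.x) ∈ M′
      half = realize walk C.chain sub₁
      half′ : Linked (Realized M′) (z ∷ front) × (z , C.x′) ∈ M′
      half′ = realize walk′ C.chain′ sub₂
      middle-realized : Realized M′ r z
      middle-realized c e with trans (sym rz) e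
      ... | refl = C.x , C.x′ , proj₂ half , proj₂ half′ , C.bridge
      path-done : Linked (Realized M′) (fullPath i j)
      path-done = subst (Linked (Realized M′)) (sym path≡)
        (linked-ʳ++⁺ (λ {u} {v} → Realized-sym M′ {u} {v}) (proj₁ half) (middle-realized ∷ proj₁ half′))
      degrees′ : ∀ {l v} → (branch l , v) ∈ M′ → occ v (parents (C.P′ ++ C.P ++ E)) ≤ deg l ((i , j) ∷ L)
      -- Every branch vertex was placed in `M` already; uniqueness of the enlarged domain identifies
      -- that old image with `v`.
      degrees′ {l} {v} p∈ with place (branches l)
      ... | v₀ , q∈ with cong proj₂ (unique-map-injective proj₁ (subst Unique (sym dom) dom′-unique) p∈ (old q∈) refl)
      ...   | refl = ≤-trans (C.degrees (image-child q∈))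
        (+-mono-≤ (⟦⟧-mono (same a′-at)) (+-mono-≤ (⟦⟧-mono (same a-at)) (degrees q∈)))
        where
        same : ∀ {i a} → (branch i , a) ∈ M → does (v ≟ a) ≡ true → does (l ≟ i) ≡ true
        same {i} {a} at e with v ≟ a
        ... | yes refl = dec-true (l ≟ i) (branchInj (injective q∈ at))

  attach : ∀ {i j L} → i <ᶠ j → (i , j) ∉ L → All (λ p → proj₁ p <ᶠ proj₂ p) L →
    deg i L < D → deg j L < D → Partial L → Partial ((i , j) ∷ L)
  attach {i} {j} {L} i<j ij∉ lt slack slack′ part
    -- One stem edge and `k` levels of branching need `k + 1` inner vertices on each side of the
    -- middle edge. Exactly that many go to the side of branch `i`, and the rest to branch `j`.
    with cut-at k (inner i j) (≤-trans (≤-trans (≤-reflexive (+-comm 2 k)) (+-mono-≤ (m≤m+n k _) (n≤1+n 2))) (longPaths i j i<j))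
  ... | r , rs , z , zs , inner≡ , length-rs , length-inner
    with Attach.halves i<j ij∉ lt part {r} {rs} {z} {zs} inner≡
  ... | l , (e ∷ l′) with just-of e | colours l | colours l′
  ... | c₀ , rz | cs , walk , len | cs′ , walk′ , len′
    with Partial.place part (Partial.branches part i) | Partial.place part (Partial.branches part j)
  ... | a , a-at | a′ , a′-at =
    T.install a-at a′-at walk walk′ rz length-cs length-cs′
      (T.connection c₀ a-at a′-at length-cs length-cs′ k<cs k<cs′ slack slack′)
    where
    module T = Attach i<j ij∉ lt part {r} {rs} {z} {zs} inner≡
    length-cs : length cs ≡ suc (length rs)
    length-cs = trans len (length-∷ʳ rs)
    length-cs′ : length cs′ ≡ suc (length zs)
    length-cs′ = trans len′ (length-∷ʳ zs)
    k<cs : k < length cs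
    k<cs = ≤-reflexive (trans (cong suc (sym length-rs)) (sym length-cs))
    k<cs′ : k < length cs′
    k<cs′ = ≤-trans (+-cancelʳ-≤ (suc k) (suc k) (suc (length zs)) (begin
      suc k + suc k               ≤⟨ m≤m+n _ 1 ⟩
      suc k + suc k + 1           ≡⟨ double k ⟩
      2 * k + 3                   ≤⟨ longPaths i j i<j ⟩
      length (inner i j)          ≡⟨ length-inner ⟨
      suc (length zs) + suc k     ∎)) (≤-reflexive (sym length-cs′))
      where
      open ≤-Reasoning
      double : ∀ k → suc k + suc k + 1 ≡ 2 * k + 3
      double = solve-∀

  attachAll : ∀ L → Unique L → All (λ p → proj₁ p <ᶠ proj₂ p) L → Partial L
  attachAll [] _ _ = start
  attachAll ((i , j) ∷ L) (p∉ ∷ u) (i<j ∷ lt) =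
    attach i<j (λ p∈ → All.lookup p∉ p∈ refl) lt
      -- The strict bounds before adding `(i , j)` come from `deg≤D` applied after adding it, when
      -- both ends have gained one.
      (≤-trans (≤-trans (≤-reflexive (cong (λ b → ⟦ b ⟧ + deg i L) (sym (≟-refl i)))) (m≤n+m _ ⟦ does (i ≟ j) ⟧)) (deg≤D i all-unique (i<j ∷ lt)))
      (≤-trans (≤-trans (s≤s (m≤n+m _ ⟦ does (j ≟ i) ⟧)) (≤-reflexive (cong (λ b → ⟦ b ⟧ + (⟦ does (j ≟ i) ⟧ + deg j L)) (sym (≟-refl j))))) (deg≤D j all-unique (i<j ∷ lt)))
      (attachAll L u lt)
    where
    all-unique : Unique ((i , j) ∷ L)
    all-unique = p∉ ∷ u

  pairs : List (Fin D × Fin D)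
  pairs = filter (λ p → proj₁ p <ᶠ? proj₂ p) (cartesianProduct (allFin D) (allFin D))

  pairs-increasing : All (λ p → proj₁ p <ᶠ proj₂ p) pairs
  pairs-increasing = All.tabulate λ p∈ → proj₂ (∈-filter⁻ (λ p → proj₁ p <ᶠ? proj₂ p) {xs = cartesianProduct (allFin D) (allFin D)} p∈)

  ∈-pairs : ∀ {i j} → i <ᶠ j → (i , j) ∈ pairs
  ∈-pairs {i} {j} = ∈-filter⁺ (λ p → proj₁ p <ᶠ? proj₂ p) (∈-cartesianProduct⁺ (∈-allFin i) (∈-allFin j))

  contains : Contains G H
  contains = φ , φ-injective , φ-edge
    where
    open Partial (attachAll pairs (filter⁺ _ (cartesianProduct⁺ (allFin⁺ D) (allFin⁺ D))) pairs-increasing)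
    placed : ∀ x → ∃[ v ] (x , v) ∈ M
    placed x with verticesCovered x
    ... | inj₁ (i , refl) = place (branches i)
    ... | inj₂ (i , j , i<j , x∈) = place (inners (∈-pairs i<j) x∈)
    φ : Fin m → Fin n
    φ x = proj₁ (placed x)
    φ-injective : ∀ {x y} → φ x ≡ φ y → x ≡ y
    φ-injective {x} {y} e = injective (proj₂ (placed x)) (subst (λ v → (y , v) ∈ M) (sym e) (proj₂ (placed y)))
    realized : ∀ u v → IsEdge H u v → Realized M u v
    realized u v e with edgesCovered u v e
    ... | i , j , i<j , inj₁ (pre , suf , eq) = linked-consecutive pre (subst (Linked (Realized M)) eq (done (∈-pairs i<j)))
    ... | i , j , i<j , inj₂ (pre , suf , eq) = Realized-sym M {v} {u} (linked-consecutive pre (subst (Linked (Realized M)) eq (done (∈-pairs i<j))))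
    φ-edge : ∀ u v c → col H u v ≡ just c → adj (G c) (φ u) (φ v) ≡ true
    φ-edge u v c e with realized u v (subst Is-just (sym e) (just tt)) c e
    ... | u′ , v′ , u∈ , v∈ , ad =
      subst₂ (λ x y → adj (G c) x y ≡ true) (functional u∈ (proj₂ (placed u))) (functional v∈ (proj₂ (placed v))) ad

theorem1p4 : (s t D n m k : ℕ) → 1 ≤ s → 1 ≤ t → 3 ≤ D →
    IsCeilLog (D ∸ 1) s k →
    (G : GraphFamily n t) → SJoined s G →
    (H : ColoredGraph m t) → SubdivisionOfK H D (2 * k + 3) →
    MaxMonoDegreeAtMost H D →
    m + 6 * s * D ≤ n →
    Contains G H
theorem1p4 s t D n m k 1≤s _ 3≤D ceil G sjoined H subdivision _ m+6sD≤n =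
  Embedding.contains s D m k G sjoined 1≤s 3≤D ceil saturatedAdj discarded saturated-joined
    (λ E → room E m+6sD≤n) saturated-sound Ext-[] H subdivision
  where
  open Expansion s D G sjoined 1≤s 3≤D (≤-trans (m≤n+m _ m) m+6sD≤n)
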